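{- For any $m\ge2$, the algorithm ALG($5/3$) (the algorithm ALG($c$) of the context with $c=5/3$) is $5/3$-competitive and uses at most $4m$ job migrations on every job sequence.
   Context: Problem: jobs $J_1,\dots,J_n$ with processing times $p_i>0$ arrive online and must be assigned non-preemptively and immediately to one of $m$ identical machines $M_1,\dots,M_m$; a migration removes an assigned job and reassigns it. Makespan = maximum machine load in the final schedule; an algorithm is $c$-competitive if its makespan is at most $c$ times the optimum offline makespan on every sequence. Notation: $p_t^+=\sum_{i\le t}p_i$; $p_t^i$ = $i$-th largest processing time among $J_1,\dots,J_t$ ($0$ if $i>t$). $L_t=\max\{p_t^+/m,\ p_t^1,\ 2p_t^{m+1}\}$. Job $J_i$, $i\le t$, is small at time $t$ if $p_i\le(2c-3)L_t$; $J_t$ is small if small at time $t$, large otherwise. $\ell(j,t)$ = load of $M_j$ just before $J_t$ is assigned; $\ell_s(j,t)$ = same load counting only jobs small at time $t$. $A=\{M_1,\dots,M_{\lfloor m/2\rfloor}\}$, $B=\{M_{\lfloor m/2\rfloor+1},\dots,M_m\}$. Algorithm ALG($c$). Arrival phase: if $J_t$ is small, let $A'=\{M_j\in A:\ell_s(j,t)\le(c-1)L_t\}$; if $A'\ne\emptyset$ assign $J_t$ to a machine of $A'$ with smallest $\ell_s(j,t)$, otherwise to a least loaded machine of $B$. If $J_t$ is large: if some $M_j\in A$ has $\ell(j,t)\le(3-c)L_t$, assign $J_t$ to a least loaded machine of $A$, otherwise to a least loaded machine of $B$. Let $L=L_n$. Migration phase ($\ell(j)$ = current load): removal: $R=\emptyset$;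 from every machine of $B$ remove its largest job into $R$; while some $M_j\in A$ has $\ell(j)>(c-1)L$, remove its largest job into $R$. Reassignment: sort $R$ by non-increasing processing time; for each job $J$ in this order, if some $M_j\in B$ has $\ell(j)+p(J)\le cL$ assign $J$ there, otherwise to a least loaded machine of $A$. Each job of $R$ counts as one migration.
   Formalization: The processing times of the jobs are taken to be positive rational numbers instead of positive real numbers. -}

module Defs where

open import Data.Nat as ℕ using (ℕ; zero; suc; ⌊_/2⌋)
open import Data.Fin using (Fin; toℕ; _≟_)
open import Data.Integer using (+_)
open import Data.Rational using (ℚ; 0ℚ; _+_; _*_; _-_; _≤_; _⊔_; _/_)
open import Data.Rational.Properties using (_≤?_)
open import Data.List using (List; []; _∷_; _∷ʳ_; foldr; map; concat; allFin; length; filter)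
open import Data.List.Relation.Binary.Permutation.Propositional using (_↭_)
open import Data.Bool using (if_then_else_)
open import Data.Product using (Σ; ∃; _×_; _,_; proj₁; proj₂)
open import Relation.Nullary using (¬_; does)
open import Relation.Binary.PropositionalEquality using (_≡_)

sumℚ : List ℚ → ℚ
sumℚ = foldr _+_ 0ℚ

insertDesc : ℚ → List ℚ → List ℚ
insertDesc x [] = x ∷ []
insertDesc x (y ∷ ys) = if does (y ≤? x) then x ∷ y ∷ ys else y ∷ insertDesc x ys

sortDesc : List ℚ → List ℚ
sortDesc = foldr insertDesc []

-- 1-indexed i-th element of a list, 0 if out of range
kth : ℕ → List ℚ → ℚ
kth zero _ = 0ℚ
kth (suc _) [] = 0ℚ
kth (suc zero) (x ∷ _) = x
kth (suc (suc i)) (_ ∷ xs) = kth (suc i) xs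

-- p^i : i-th largest processing time among the given jobs (0 if i > #jobs)
ithLargest : ℕ → List ℚ → ℚ
ithLargest i ps = kth i (sortDesc ps)

-- 1/m (the value at m = 0 is irrelevant, m ≥ 2 throughout)
invℕ : ℕ → ℚ
invℕ zero = 0ℚ
invℕ (suc k) = + 1 / suc k

ℚ-of : ℕ → ℚ
ℚ-of n = + n / 1

LB : ℕ → List ℚ → ℚ
LB m ps = (sumℚ ps * invℕ m) ⊔ (ithLargest 1 ps ⊔ (ℚ-of 2 * ithLargest (suc m) ps))

-- Schedules: machine M_{j+1} is index j : Fin m; a machine holds the list
-- of processing times of the jobs assigned to it.

State : ℕ → Set
State m = Fin m → List ℚ

empty : ∀ {m} → State m
empty _ = []

load : ∀ {m} → State m → Fin m → ℚ
load S j = sumℚ (S j)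

makespan : ∀ m → State m → ℚ
makespan m S = foldr _⊔_ 0ℚ (map (load S) (allFin m))

addJob : ∀ {m} → State m → Fin m → ℚ → State m
addJob S j p j' = if does (j' ≟ j) then S j' ∷ʳ p else S j'

InA : ∀ m → Fin m → Set
InA m j = toℕ j ℕ.< ⌊ m /2⌋

InB : ∀ m → Fin m → Set
InB m j = ⌊ m /2⌋ ℕ.≤ toℕ j

OfflineSchedule : ∀ m → List ℚ → State m → Set
OfflineSchedule m js S = concat (map S (allFin m)) ↭ js

-- The algorithm ALG(c), as a relation (all tie-breakings allowed)

module _ (m : ℕ) (c : ℚ) where

  δ : ℚ
  δ = ℚ-of 2 * c - ℚ-of 3

  cm1 : ℚ
  cm1 = c - ℚ-of 1

  3mc : ℚ
  3mc = ℚ-of 3 - c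

  smallLoad : ℚ → State m → Fin m → ℚ
  smallLoad Lt S j = sumℚ (filter (λ q → q ≤? (δ * Lt)) (S j))

  data ArrivalChoice (S : State m) (p Lt : ℚ) : Fin m → Set where
    small-A : ∀ {j} → p ≤ δ * Lt → InA m j → smallLoad Lt S j ≤ cm1 * Lt →
              (∀ j' → InA m j' → smallLoad Lt S j' ≤ cm1 * Lt →
                 smallLoad Lt S j ≤ smallLoad Lt S j') →
              ArrivalChoice S p Lt j
    small-B : ∀ {j} → p ≤ δ * Lt →
              (∀ j' → InA m j' → ¬ (smallLoad Lt S j' ≤ cm1 * Lt)) →
              InB m j → (∀ j' → InB m j' → load S j ≤ load S j') →
              ArrivalChoice S p Lt j
    large-A : ∀ {j} → ¬ (p ≤ δ * Lt) →
              (∃ λ j' → InA m j' × load S j' ≤ 3mc * Lt) →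
              InA m j → (∀ j' → InA m j' → load S j ≤ load S j') →
              ArrivalChoice S p Lt j
    large-B : ∀ {j} → ¬ (p ≤ δ * Lt) →
              (∀ j' → InA m j' → ¬ (load S j' ≤ 3mc * Lt)) →
              InB m j → (∀ j' → InB m j' → load S j ≤ load S j') →
              ArrivalChoice S p Lt j

  data Arrivals (prefix : List ℚ) (S : State m) : List ℚ → State m → Set where
    done : Arrivals prefix S [] S
    step : ∀ {p rest j S'} →
           ArrivalChoice S p (LB m (prefix ∷ʳ p)) j →
           Arrivals (prefix ∷ʳ p) (addJob S j p) rest S' →
           Arrivals prefix S (p ∷ rest) S'

  -- removal on a machine of A (list sorted non-increasingly):
  -- while the load exceeds θ, remove the largest job. Returns (kept, removed).
  peelA : ℚ → List ℚ → List ℚ × List ℚ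
  peelA θ [] = [] , []
  peelA θ (x ∷ xs) =
    if does (sumℚ (x ∷ xs) ≤? θ) then (x ∷ xs , [])
    else (proj₁ (peelA θ xs) , x ∷ proj₂ (peelA θ xs))

  peelB : List ℚ → List ℚ × List ℚ
  peelB [] = [] , []
  peelB (x ∷ xs) = xs , x ∷ []

  peel : ℚ → State m → Fin m → List ℚ × List ℚ
  peel L S j with toℕ j ℕ.<? ⌊ m /2⌋
  ... | Relation.Nullary.yes _ = peelA (cm1 * L) (sortDesc (S j))
  ... | Relation.Nullary.no _ = peelB (sortDesc (S j))

  afterRemoval : ℚ → State m → State m
  afterRemoval L S j = proj₁ (peel L S j)

  removed : ℚ → State m → List ℚ
  removed L S = concat (map (λ j → proj₂ (peel L S j)) (allFin m))

  data Reassign (L : ℚ) (S : State m) : List ℚ → State m → Set where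
    done : Reassign L S [] S
    toB : ∀ {p rest j S'} → InB m j → load S j + p ≤ c * L →
          Reassign L (addJob S j p) rest S' → Reassign L S (p ∷ rest) S'
    toA : ∀ {p rest j S'} →
          (∀ j' → InB m j' → ¬ (load S j' + p ≤ c * L)) →
          InA m j → (∀ j' → InA m j' → load S j ≤ load S j') →
          Reassign L (addJob S j p) rest S' → Reassign L S (p ∷ rest) S'

  -- ALG-Run js S k : some run of ALG(c) on job sequence js ends with
  -- final schedule S and uses k migrations (k = |R|).
  ALG-Run : List ℚ → State m → ℕ → Set
  ALG-Run js S k =
    Σ (State m) λ Sarr →
      Arrivals [] empty js Sarr ×
      Reassign (LB m js) (afterRemoval (LB m js) Sarr)
               (sortDesc (removed (LB m js) Sarr)) S ×
      k ≡ length (removed (LB m js) Sarr)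

{-# OPTIONS --safe #-}
module Submission where

-- Write L = LB m js and a = ⌊m/2⌋, b = m - a, so a ≤ b ≤ a + 1. Only OPT ≥ L is used about the optimum.
--
-- Averaging over the machines shows that a job entering B meets a load of at most (4/3) L_t if it is small, because then
-- every machine of A carries small load above (2/3) L_t, and of at most (2/3) L_t if it is large. Hence after the removal
-- each machine of B has load at most (4/3) L, and one with load above (2/3) L received its last job at a time with
-- L_t > L/2; in that case every machine of A retains load above L/3.
--
-- Suppose a job p fits on no machine during the reassignment, so all loads exceed (5/3) L - p. Summing loads gives
-- p > (2/3) L. All jobs reassigned so far are at least p > L/2, and at most m jobs exceed L/2, so some machine received none
-- of them. It lies in B, since the loads of A were reduced to (2/3) L. So every machine of A has load at least L/3 + p, and
-- a (L/3 + p) + b ((5/3) L - p) + p > m L, which is impossible.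
--
-- A machine of A loses at most 7 jobs, which gives 7 a + b ≤ 4 m migrations. Right after the arrival of a small job, at most
-- 4 jobs exceed L_t/3 and deleting these and the new one leaves at most (2/3) L_t. If k large jobs follow, delete these
-- first; each of them is at least a quarter of the load it meets, and that load is at most (4/3) L_t, so k ≥ 5 makes
-- 5 deletions enough, and k = 3, 4 are settled by how much the jobs exceeding L_t/3 contribute to the load.

open import Defs

module ALG where
  open import Data.Nat as ℕ using (ℕ; zero; suc; z≤n; s≤s; _∸_; ⌊_/2⌋)
  import Data.Nat.Properties as ℕ
  open import Data.Fin using (Fin; zero; suc; toℕ; _≟_)
  import Data.Fin.Properties as Fin
  open import Data.Integer as ℤ using (+_)
  import Data.Integer.Properties as ℤ
  open import Data.Rational hiding (_≟_)
  open import Data.Rational.Properties hiding (_≟_)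
  import Data.Rational.Unnormalised as ℚᵘ
  import Data.Rational.Unnormalised.Properties as ℚᵘ
  open import Data.Rational.Solver
  open import Data.List using (List; []; _∷_; _∷ʳ_; _++_; map; concat; foldr; allFin;
    length; filter; lookup; tabulate; drop)
  open import Data.List.Properties using (map-tabulate; tabulate-cong; ++-identityʳ; filter-++; length-++;
    filter-accept; filter-reject; filter-none; length-filter; filter-all; ++-assoc)
  open import Data.List.Relation.Unary.All as All using (All; []; _∷_)
  import Data.List.Relation.Unary.All.Properties as All
  open import Data.List.Relation.Unary.Any using (here; there; index; any?)
  open import Data.List.Relation.Unary.Any.Properties using (lookup-index)
  open import Data.List.Relation.Unary.AllPairs as AllPairs using (AllPairs; []; _∷_)
  open import Data.List.Membership.Propositional using (_∈_)
  open import Data.List.Membership.Propositional.Properties using (∈-map⁺; ∈-allFin)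
  open import Data.List.Relation.Binary.Permutation.Propositional
  open import Data.List.Relation.Binary.Permutation.Propositional.Properties using
    (↭-length; filter-↭; All-resp-↭; ++⁺; ++⁺ˡ; ++⁺ʳ; ∷↭∷ʳ; shift; shifts)
  open import Data.Product using (∃; _×_; _,_; proj₁; proj₂)
  open import Data.Sum using (_⊎_; inj₁; inj₂)
  open import Data.Empty using (⊥; ⊥-elim)
  open import Function using (_∘_; id)
  open import Relation.Nullary using (¬_; yes; no; contradiction)
  open import Relation.Nullary.Decidable using (dec-true; dec-false; True; toWitness)
  open import Data.Bool using (if_then_else_)
  open import Relation.Binary.PropositionalEquality as ≡ using (_≡_; cong; cong₂; subst)
  open +-*-Solver using (solve; _:+_; _:*_; _:-_; _:=_; con)
  open import Data.Nat.Solver using () renaming (module +-*-Solver to ℕ-Solver)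
  open ℕ-Solver using () renaming (solve to ℕ-solve; _:+_ to _ℕ:+_; _:*_ to _ℕ:*_; _:=_ to _ℕ:=_; con to ℕcon)

  -- Certificates for inequalities over the rationals.

  0≤-diff : ∀ {x y} → x ≤ y → 0ℚ ≤ y - x
  0≤-diff {x} {y} h = subst (_≤ y - x) (+-inverseʳ x) (+-monoˡ-≤ (- x) h)

  0<-diff : ∀ {x y} → x < y → 0ℚ < y - x
  0<-diff {x} {y} h = subst (_< y - x) (+-inverseʳ x) (+-monoˡ-< (- x) h)

  infixl 6 _⊕_
  _⊕_ : ∀ {x y} → 0ℚ ≤ x → 0ℚ ≤ y → 0ℚ ≤ x + y
  _⊕_ = +-mono-≤

  infixr 7 _⊛_
  _⊛_ : ∀ {x y} → 0ℚ ≤ x → 0ℚ ≤ y → 0ℚ ≤ x * y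
  _⊛_ {x} {y} hx hy = subst (_≤ x * y) (*-zeroʳ x) (*-monoˡ-≤-nonNeg x {{nonNegative hx}} hy)

  lit : ∀ x {{_ : NonNegative x}} → 0ℚ ≤ x
  lit x = nonNegative⁻¹ x

  -- Inequalities below are proved by certificate: the ring solver checks an identity exhibiting the
  -- slack `d`, and `_⊕_`, `_⊛_`, `lit`, `0≤-diff` build its sign from known factors. `⊥-by` is the
  -- refuting form, where a positive combination of the hypotheses vanishes identically.
  ≤-by : ∀ {x y d} → y ≡ x + d → 0ℚ ≤ d → x ≤ y
  ≤-by {x} {y} {d} e h = subst₂≤ (+-identityʳ x) (≡.sym e) (+-monoʳ-≤ x h)
    where
    subst₂≤ : ∀ {a b c e} → a ≡ b → c ≡ e → a ≤ c → b ≤ e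
    subst₂≤ ≡.refl ≡.refl h = h

  ⊥-by : ∀ {d} → d ≡ 0ℚ → 0ℚ < d → ⊥
  ⊥-by e h = <-irrefl (≡.sym e) h

  -- Sums and sorting of job lists.

  sum-++ : ∀ xs ys → sumℚ (xs ++ ys) ≡ sumℚ xs + sumℚ ys
  sum-++ [] ys = ≡.sym (+-identityˡ _)
  sum-++ (x ∷ xs) ys = ≡.trans (cong (_+_ x) (sum-++ xs ys)) (≡.sym (+-assoc x _ _))

  sum-∷ʳ : ∀ xs x → sumℚ (xs ∷ʳ x) ≡ sumℚ xs + x
  sum-∷ʳ xs x = ≡.trans (sum-++ xs (x ∷ [])) (cong (_+_ (sumℚ xs)) (+-identityʳ x))

  sum-↭ : ∀ {xs ys} → xs ↭ ys → sumℚ xs ≡ sumℚ ys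
  sum-↭ refl = ≡.refl
  sum-↭ (prep x p) = cong (_+_ x) (sum-↭ p)
  sum-↭ (swap {xs} {ys} x y p) =
    ≡.trans (≡.sym (+-assoc x y _))
    (≡.trans (cong₂ _+_ (+-comm x y) (sum-↭ p)) (+-assoc y x _))
  sum-↭ (trans p q) = ≡.trans (sum-↭ p) (sum-↭ q)

  sum≥0 : ∀ {xs} → All (0ℚ ≤_) xs → 0ℚ ≤ sumℚ xs
  sum≥0 [] = ≤-refl
  sum≥0 (h ∷ hs) = h ⊕ sum≥0 hs

  Desc : List ℚ → Set
  Desc = AllPairs (λ x y → y ≤ x)

  insert-front : ∀ {x y} ys → y ≤ x → insertDesc x (y ∷ ys) ≡ x ∷ y ∷ ys
  insert-front {x} {y} ys h = cong (if_then x ∷ y ∷ ys else y ∷ insertDesc x ys) (dec-true (y ≤? x) h)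

  insert-past : ∀ {x y} ys → ¬ y ≤ x → insertDesc x (y ∷ ys) ≡ y ∷ insertDesc x ys
  insert-past {x} {y} ys h = cong (if_then x ∷ y ∷ ys else y ∷ insertDesc x ys) (dec-false (y ≤? x) h)

  insert-↭ : ∀ x ys → insertDesc x ys ↭ x ∷ ys
  insert-↭ x [] = refl
  insert-↭ x (y ∷ ys) with y ≤? x
  ... | yes h = ↭-reflexive (insert-front ys h)
  ... | no h = trans (↭-reflexive (insert-past ys h)) (trans (prep y (insert-↭ x ys)) (swap y x refl))

  sort-↭ : ∀ xs → sortDesc xs ↭ xs
  sort-↭ [] = refl
  sort-↭ (x ∷ xs) = trans (insert-↭ x (sortDesc xs)) (prep x (sort-↭ xs))

  insert-desc : ∀ x {ys} → Desc ys → Desc (insertDesc x ys)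
  insert-desc x [] = [] ∷ []
  insert-desc x (_∷_ {y} {ys} h hs) with y ≤? x
  ... | yes y≤x = subst Desc (≡.sym (insert-front ys y≤x)) ((y≤x ∷ All.map (λ z≤y → ≤-trans z≤y y≤x) h) ∷ h ∷ hs)
  ... | no y≰x = subst Desc (≡.sym (insert-past ys y≰x))
    (All-resp-↭ (↭-sym (insert-↭ x ys)) (<⇒≤ (≰⇒> y≰x) ∷ h) ∷ insert-desc x hs)

  sort-desc : ∀ xs → Desc (sortDesc xs)
  sort-desc [] = []
  sort-desc (x ∷ xs) = insert-desc x (sort-desc xs)

  -- Order statistics as counts above a threshold.

  above : ℚ → List ℚ → List ℚ
  above v = filter (v <?_)

  #above : ℚ → List ℚ → ℕ
  #above v xs = length (above v xs)

  #above-↭ : ∀ v {xs ys} → xs ↭ ys → #above v xs ≡ #above v ys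
  #above-↭ v p = ↭-length (filter-↭ (v <?_) p)

  #above-++ : ∀ v xs ys → #above v (xs ++ ys) ≡ #above v xs ℕ.+ #above v ys
  #above-++ v xs ys = ≡.trans (cong length (filter-++ (v <?_) xs ys)) (length-++ (above v xs))

  #above-none : ∀ {v xs} → All (_≤ v) xs → #above v xs ≡ 0
  #above-none {v} h = cong length (filter-none (v <?_) (All.map (λ x≤v v<x → <-irrefl ≡.refl (<-≤-trans v<x x≤v)) h))

  #above-∷ : ∀ {v x} xs → v < x → #above v (x ∷ xs) ≡ suc (#above v xs)
  #above-∷ {v} xs h = cong length (filter-accept (v <?_) h)

  #above-skip : ∀ {v x} xs → ¬ v < x → #above v (x ∷ xs) ≡ #above v xs
  #above-skip {v} xs h = cong length (filter-reject (v <?_) h)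

  #above≡0⇒All≤ : ∀ {v} xs → #above v xs ℕ.≤ 0 → All (_≤ v) xs
  #above≡0⇒All≤ [] _ = []
  #above≡0⇒All≤ {v} (x ∷ xs) h with v <? x
  ... | yes v<x = contradiction (subst (ℕ._≤ 0) (#above-∷ xs v<x) h) λ ()
  ... | no v≮x = ≮⇒≥ v≮x ∷ #above≡0⇒All≤ xs (subst (ℕ._≤ 0) (#above-skip xs v≮x) h)

  -- With `#above≤` this trades order statistics for counts, which are invariant under permutation
  -- and additive under `_++_`. The hypothesis `0ℚ ≤ v` accounts for the default value 0 of `kth`
  -- past the end of the list.
  kth≤ : ∀ {v} i {xs} → Desc xs → 0ℚ ≤ v → #above v xs ℕ.≤ i → kth (suc i) xs ≤ v
  kth≤ i [] 0≤v _ = 0≤v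
  kth≤ {v} zero (_∷_ {x} {xs} h hs) 0≤v c = All.head (#above≡0⇒All≤ (x ∷ xs) c)
  kth≤ {v} (suc i) (_∷_ {x} {xs} h hs) 0≤v c with v <? x
  ... | yes v<x = kth≤ i hs 0≤v (ℕ.≤-pred (subst (ℕ._≤ suc i) (#above-∷ xs v<x) c))
  ... | no v≮x = kth≤ i hs 0≤v
    (subst (ℕ._≤ i) (≡.sym (#above-none (All.map (λ y≤x → ≤-trans y≤x (≮⇒≥ v≮x)) h))) z≤n)

  #above≤ : ∀ {v} i {xs} → Desc xs → kth (suc i) xs ≤ v → #above v xs ℕ.≤ i
  #above≤ i [] _ = z≤n
  #above≤ {v} i (_∷_ {x} {xs} h hs) k with v <? x
  #above≤ i (_∷_ {x} {xs} h hs) k | no v≮x =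
    subst (ℕ._≤ i) (≡.sym (#above-none (≮⇒≥ v≮x ∷ All.map (λ y≤x → ≤-trans y≤x (≮⇒≥ v≮x)) h))) z≤n
  #above≤ zero (h ∷ hs) k | yes v<x = ⊥-elim (<-irrefl ≡.refl (<-≤-trans v<x k))
  #above≤ (suc i) (_∷_ {x} {xs} h hs) k | yes v<x =
    subst (ℕ._≤ suc i) (≡.sym (#above-∷ xs v<x)) (s≤s (#above≤ i hs k))

  ithLargest≤ : ∀ {v} i xs → 0ℚ ≤ v → #above v xs ℕ.≤ i → ithLargest (suc i) xs ≤ v
  ithLargest≤ {v} i xs 0≤v c =
    kth≤ i (sort-desc xs) 0≤v (subst (ℕ._≤ i) (≡.sym (#above-↭ v (sort-↭ xs))) c)

  #above≤ithLargest : ∀ {v} i xs → ithLargest (suc i) xs ≤ v → #above v xs ℕ.≤ i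
  #above≤ithLargest {v} i xs k =
    subst (ℕ._≤ i) (#above-↭ v (sort-↭ xs)) (#above≤ i (sort-desc xs) k)

  -- Machine counts as rationals.

  -- Since `_/_` divides by a gcd, neither side reduces for variable `a` and `b`; the identity is
  -- checked on unnormalised fractions and pulled back along `toℚᵘ`.
  ℚ-of-+ : ∀ a b → ℚ-of (a ℕ.+ b) ≡ ℚ-of a + ℚ-of b
  ℚ-of-+ a b = toℚᵘ-injective (begin
    toℚᵘ (ℚ-of (a ℕ.+ b))                ≈⟨ toℚᵘ-fromℚᵘ (ℚᵘ.mkℚᵘ (+ (a ℕ.+ b)) 0) ⟩
    ℚᵘ.mkℚᵘ (+ (a ℕ.+ b)) 0              ≈⟨ ℚᵘ.*≡* (cong (ℤ._* + 1) (≡.trans (ℤ.pos-+ a b)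
                                               (≡.sym (cong₂ ℤ._+_ (ℤ.*-identityʳ (+ a)) (ℤ.*-identityʳ (+ b)))))) ⟩
    ℚᵘ.mkℚᵘ (+ a) 0 ℚᵘ.+ ℚᵘ.mkℚᵘ (+ b) 0 ≈⟨ ℚᵘ.+-cong (ℚᵘ.≃-sym (toℚᵘ-fromℚᵘ (ℚᵘ.mkℚᵘ (+ a) 0)))
                                                       (ℚᵘ.≃-sym (toℚᵘ-fromℚᵘ (ℚᵘ.mkℚᵘ (+ b) 0))) ⟩
    toℚᵘ (ℚ-of a) ℚᵘ.+ toℚᵘ (ℚ-of b)     ≈⟨ ℚᵘ.≃-sym (toℚᵘ-homo-+ (ℚ-of a) (ℚ-of b)) ⟩
    toℚᵘ (ℚ-of a + ℚ-of b)               ∎)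
    where open ℚᵘ.≃-Reasoning

  ℚ-of-inv : ∀ k → ℚ-of (suc k) * invℕ (suc k) ≡ 1ℚ
  ℚ-of-inv k = toℚᵘ-injective (begin
    toℚᵘ (ℚ-of (suc k) * invℕ (suc k))         ≈⟨ toℚᵘ-homo-* (ℚ-of (suc k)) (invℕ (suc k)) ⟩
    toℚᵘ (ℚ-of (suc k)) ℚᵘ.* toℚᵘ (invℕ (suc k)) ≈⟨ ℚᵘ.*-cong (toℚᵘ-fromℚᵘ (ℚᵘ.mkℚᵘ (+ suc k) 0))
                                                             (toℚᵘ-fromℚᵘ (ℚᵘ.mkℚᵘ (+ 1) k)) ⟩
    ℚᵘ.mkℚᵘ (+ suc k) 0 ℚᵘ.* ℚᵘ.mkℚᵘ (+ 1) k    ≈⟨ ℚᵘ.*≡* (≡.trans (ℤ.*-identityʳ (+ suc k ℤ.* + 1))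
                                                   (≡.trans (ℤ.*-identityʳ (+ suc k))
                                                   (≡.sym (≡.trans (ℤ.*-identityˡ (+ (1 ℕ.* suc k))) (cong +_ (ℕ.*-identityˡ (suc k))))))) ⟩
    toℚᵘ 1ℚ ∎)
    where open ℚᵘ.≃-Reasoning

  ℚ-of≥0 : ∀ n → 0ℚ ≤ ℚ-of n
  ℚ-of≥0 n = nonNegative⁻¹ (ℚ-of n) {{normalize-nonNeg n 1}}

  invℕ≥0 : ∀ n → 0ℚ ≤ invℕ n
  invℕ≥0 zero = ≤-refl
  invℕ≥0 (suc k) = nonNegative⁻¹ (invℕ (suc k)) {{normalize-nonNeg 1 (suc k)}}

  ℚ-of-mono : ∀ {a b} → a ℕ.≤ b → ℚ-of a ≤ ℚ-of b
  ℚ-of-mono {a} {b} h = ≤-by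
    (≡.trans (cong ℚ-of (≡.sym (ℕ.m+[n∸m]≡n h))) (ℚ-of-+ a (b ∸ a))) (ℚ-of≥0 (b ∸ a))

  <⇒≱ : ∀ {x y} → x < y → ¬ y ≤ x
  <⇒≱ x<y y≤x = <-irrefl ≡.refl (<-≤-trans x<y y≤x)

  kth≥0 : ∀ i {xs} → All (0ℚ ≤_) xs → 0ℚ ≤ kth i xs
  kth≥0 zero _ = ≤-refl
  kth≥0 (suc i) [] = ≤-refl
  kth≥0 (suc zero) (h ∷ hs) = h
  kth≥0 (suc (suc i)) (h ∷ hs) = kth≥0 (suc i) hs

  ithLargest≥0 : ∀ i {xs} → All (0ℚ ≤_) xs → 0ℚ ≤ ithLargest i xs
  ithLargest≥0 i {xs} h = kth≥0 i (All-resp-↭ (↭-sym (sort-↭ xs)) h)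

  ithLargest-mono : ∀ i {xs} ys → All (0ℚ ≤_) xs → All (0ℚ ≤_) ys →
    ithLargest (suc i) xs ≤ ithLargest (suc i) (xs ++ ys)
  ithLargest-mono i {xs} ys hx hy = ithLargest≤ i xs v≥0
    (ℕ.≤-trans (ℕ.≤-trans (ℕ.m≤m+n _ _) (ℕ.≤-reflexive (≡.sym (#above-++ v xs ys)))) (#above≤ithLargest i (xs ++ ys) ≤-refl))
    where
    v = ithLargest (suc i) (xs ++ ys)
    v≥0 : 0ℚ ≤ v
    v≥0 = ithLargest≥0 (suc i) (All.++⁺ hx hy)

  -- Splitting a load at a threshold.

  below : ℚ → List ℚ → List ℚ
  below v = filter (_≤? v)

  below-∷ : ∀ {v x} xs → x ≤ v → sumℚ (below v (x ∷ xs)) ≡ x + sumℚ (below v xs)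
  below-∷ {v} xs h = cong sumℚ (filter-accept (_≤? v) h)

  below-skip : ∀ {v x} xs → ¬ x ≤ v → sumℚ (below v (x ∷ xs)) ≡ sumℚ (below v xs)
  below-skip {v} xs h = cong sumℚ (filter-reject (_≤? v) h)

  above+below : ∀ v xs → sumℚ xs ≡ sumℚ (above v xs) + sumℚ (below v xs)
  above+below v [] = ≡.refl
  above+below v (x ∷ xs) with v <? x
  ... | yes v<x = ≡.trans (cong (_+_ x) (above+below v xs)) (≡.trans (≡.sym (+-assoc x _ _))
    (cong₂ _+_ (≡.sym (cong sumℚ (filter-accept (v <?_) v<x))) (≡.sym (below-skip xs (<⇒≱ v<x)))))
  ... | no v≮x = ≡.trans (cong (_+_ x) (above+below v xs))
    (≡.trans (solve 3 (λ x a b → x :+ (a :+ b) := a :+ (x :+ b)) ≡.refl x (sumℚ (above v xs)) (sumℚ (below v xs)))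
    (cong₂ _+_ (≡.sym (cong sumℚ (filter-reject (v <?_) v≮x))) (≡.sym (below-∷ xs (≮⇒≥ v≮x)))))

  ℚ-of-suc-* : ∀ n v → ℚ-of (suc n) * v ≡ v + ℚ-of n * v
  ℚ-of-suc-* n v = ≡.trans (cong (_* v) (ℚ-of-+ 1 n))
    (solve 2 (λ n v → (con 1ℚ :+ n) :* v := v :+ n :* v) ≡.refl (ℚ-of n) v)

  length*<sum : ∀ {v ys} n → 0ℚ ≤ v → All (v <_) ys → suc n ℕ.≤ length ys → ℚ-of (suc n) * v < sumℚ ys
  length*<sum {v} {y ∷ ys} zero 0≤v (h ∷ hs) _ = subst (_< y + sumℚ ys)
    (≡.trans (+-identityʳ v) (≡.sym (*-identityˡ v)))
    (+-mono-<-≤ h (sum≥0 (All.map (λ v<z → ≤-trans 0≤v (<⇒≤ v<z)) hs)))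
  length*<sum {v} {y ∷ ys} (suc n) 0≤v (h ∷ hs) (s≤s l) =
    subst (_< y + sumℚ ys) (≡.sym (ℚ-of-suc-* (suc n) v)) (+-mono-< h (length*<sum n 0≤v hs l))

  #above*<sum : ∀ {v} n xs → 0ℚ ≤ v → suc n ℕ.≤ #above v xs → ℚ-of (suc n) * v < sumℚ (above v xs)
  #above*<sum {v} n xs 0≤v = length*<sum n 0≤v (All.all-filter (v <?_) xs)

  -- Sums and counts over the machines.

  Σ : ∀ {m} → (Fin m → ℚ) → ℚ
  Σ f = sumℚ (tabulate f)

  jobs : ∀ {m} → State m → List ℚ
  jobs S = concat (tabulate S)

  allFin-jobs : ∀ {m} (S : State m) → concat (map S (allFin m)) ≡ jobs S
  allFin-jobs S = cong concat (map-tabulate id S)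

  sum-jobs : ∀ {m} (S : State m) → sumℚ (jobs S) ≡ Σ (load S)
  sum-jobs {zero} S = ≡.refl
  sum-jobs {suc m} S = ≡.trans (sum-++ (S zero) _) (cong (_+_ (load S zero)) (sum-jobs (S ∘ suc)))

  Σ≤ : ∀ {m v} (f : Fin m → ℚ) → (∀ j → f j ≤ v) → Σ f ≤ ℚ-of m * v
  Σ≤ {zero} {v} f h = ≤-reflexive (≡.sym (*-zeroˡ v))
  Σ≤ {suc m} {v} f h = subst (Σ f ≤_) (≡.sym (ℚ-of-suc-* m v)) (+-mono-≤ (h zero) (Σ≤ (f ∘ suc) (h ∘ suc)))

  Σ-split≥ : ∀ {m} a {α β} (f : Fin m → ℚ) → a ℕ.≤ m →
    (∀ j → toℕ j ℕ.< a → α ≤ f j) → (∀ j → a ℕ.≤ toℕ j → β ≤ f j) →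
    ℚ-of a * α + ℚ-of (m ∸ a) * β ≤ Σ f
  Σ-split≥ {zero} zero {α} {β} f h hα hβ = ≤-reflexive (cong₂ _+_ (*-zeroˡ α) (*-zeroˡ β))
  Σ-split≥ {suc m} zero {α} {β} f h hα hβ = subst (_≤ Σ f)
    (≡.sym (≡.trans (cong (_+_ (0ℚ * α)) (ℚ-of-suc-* m β))
      (solve 3 (λ a b m → con 0ℚ :* a :+ (b :+ m :* b) := b :+ (con 0ℚ :* a :+ m :* b)) ≡.refl α β (ℚ-of m))))
    (+-mono-≤ (hβ zero z≤n) (Σ-split≥ zero {α} {β} (f ∘ suc) z≤n (λ j ()) (λ j _ → hβ (suc j) z≤n)))
  Σ-split≥ {suc m} (suc a) {α} {β} f (s≤s h) hα hβ = subst (_≤ Σ f)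
    (≡.sym (≡.trans (cong (_+ ℚ-of (m ∸ a) * β) (ℚ-of-suc-* a α)) (+-assoc α _ _)))
    (+-mono-≤ (hα zero (s≤s z≤n)) (Σ-split≥ a (f ∘ suc) h (λ j → hα (suc j) ∘ s≤s) (λ j → hβ (suc j) ∘ s≤s)))

  length-jobs≤ : ∀ {m} a {α β} (S : State m) → a ℕ.≤ m →
    (∀ j → toℕ j ℕ.< a → length (S j) ℕ.≤ α) → (∀ j → a ℕ.≤ toℕ j → length (S j) ℕ.≤ β) →
    length (jobs S) ℕ.≤ a ℕ.* α ℕ.+ (m ∸ a) ℕ.* β
  length-jobs≤ {zero} a S h hα hβ = z≤n
  length-jobs≤ {suc m} zero {α} {β} S h hα hβ = subst (ℕ._≤ suc m ℕ.* β) (≡.sym (length-++ (S zero)))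
    (ℕ.+-mono-≤ (hβ zero z≤n) (length-jobs≤ zero {α} (S ∘ suc) z≤n (λ j ()) (λ j _ → hβ (suc j) z≤n)))
  length-jobs≤ {suc m} (suc a) {α} {β} S (s≤s h) hα hβ = ℕ.≤-trans (ℕ.≤-reflexive (length-++ (S zero)))
    (ℕ.≤-trans (ℕ.+-mono-≤ (hα zero (s≤s z≤n)) (length-jobs≤ a (S ∘ suc) h (λ j → hα (suc j) ∘ s≤s) (λ j → hβ (suc j) ∘ s≤s)))
    (ℕ.≤-reflexive (≡.sym (ℕ.+-assoc α (a ℕ.* α) _))))

  #above-jobs≤ : ∀ {m} v c (S : State m) → (∀ j → #above v (S j) ℕ.≤ c) → #above v (jobs S) ℕ.≤ m ℕ.* c
  #above-jobs≤ {zero} v c S h = z≤n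
  #above-jobs≤ {suc m} v c S h = ℕ.≤-trans (ℕ.≤-reflexive (#above-++ v (S zero) _))
    (ℕ.+-mono-≤ (h zero) (#above-jobs≤ v c (S ∘ suc) (h ∘ suc)))

  -- The makespan and the lower bound `LB`.

  ∈-maximum : ∀ {x xs} → x ∈ xs → x ≤ foldr _⊔_ 0ℚ xs
  ∈-maximum {xs = x ∷ xs} (here ≡.refl) = p≤p⊔q x _
  ∈-maximum {xs = y ∷ xs} (there h) = ≤-trans (∈-maximum h) (p≤q⊔p y _)

  maximum≤ : ∀ {v xs} → 0ℚ ≤ v → All (_≤ v) xs → foldr _⊔_ 0ℚ xs ≤ v
  maximum≤ 0≤v [] = 0≤v
  maximum≤ 0≤v (h ∷ hs) = ⊔-lub h (maximum≤ 0≤v hs)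

  load≤makespan : ∀ {m} (S : State m) j → load S j ≤ makespan m S
  load≤makespan {m} S j = ∈-maximum {xs = map (load S) (allFin m)} (∈-map⁺ (load S) (∈-allFin j))

  makespan≤ : ∀ {m v} (S : State m) → 0ℚ ≤ v → (∀ j → load S j ≤ v) → makespan m S ≤ v
  makespan≤ {m} S 0≤v h = maximum≤ {xs = map (load S) (allFin m)} 0≤v (All.map⁺ (All.tabulate (λ {j} _ → h j)))

  ∈⇒≤sum : ∀ {x xs} → All (0ℚ ≤_) xs → x ∈ xs → x ≤ sumℚ xs
  ∈⇒≤sum {x} {_ ∷ xs} (h ∷ hs) (here ≡.refl) = subst (_≤ x + sumℚ xs) (+-identityʳ x) (+-monoʳ-≤ x (sum≥0 hs))
  ∈⇒≤sum {x} {y ∷ xs} (h ∷ hs) (there i) = subst (_≤ y + sumℚ xs) (+-identityˡ x) (+-mono-≤ h (∈⇒≤sum hs i))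

  all-≤sum : ∀ {xs} → All (0ℚ ≤_) xs → All (_≤ sumℚ xs) xs
  all-≤sum h = All.tabulate (∈⇒≤sum h)

  above-sum≤ : ∀ v {xs} → All (0ℚ ≤_) xs → sumℚ (above v xs) ≤ sumℚ xs
  above-sum≤ v {xs} h = ≤-by (above+below v xs) (sum≥0 (All.filter⁺ (_≤? v) h))

  below-sum≤ : ∀ v {xs} → All (0ℚ ≤_) xs → sumℚ (below v xs) ≤ sumℚ xs
  below-sum≤ v {xs} h = ≤-by (≡.trans (above+below v xs) (+-comm (sumℚ (above v xs)) (sumℚ (below v xs))))
    (sum≥0 (All.filter⁺ (v <?_) h))

  jobs-All : ∀ {m} {P : ℚ → Set} (S : State m) → All P (jobs S) → ∀ j → All P (S j)
  jobs-All S h j = All.tabulate⁻ (All.concat⁻ h) j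

  -- Each term of `LB` is bounded separately, with M the makespan of `S`: the total load is at most
  -- m M; no job exceeds the load of its machine; and no machine holds two jobs above M/2, so at
  -- most m jobs exceed M/2.
  LB≤makespan : ∀ {m js} (S : State m) → 0 ℕ.< m → All (0ℚ ≤_) js → OfflineSchedule m js S → LB m js ≤ makespan m S
  LB≤makespan {m} {js} S 0<m@(s≤s {n = k} _) js≥0 perm = ⊔-lub average (⊔-lub largest twice)
    where
    M = makespan m S
    perm' : jobs S ↭ js
    perm' = subst (_↭ js) (allFin-jobs S) perm
    S≥0 : ∀ j → All (0ℚ ≤_) (S j)
    S≥0 = jobs-All S (All-resp-↭ (↭-sym perm') js≥0)
    M≥0 : 0ℚ ≤ M
    M≥0 = ≤-trans (sum≥0 (S≥0 zero)) (load≤makespan S zero)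
    average : sumℚ js * invℕ m ≤ M
    average = subst (sumℚ js * invℕ m ≤_)
      (≡.trans (solve 3 (λ a b c → a :* b :* c := a :* c :* b) ≡.refl (ℚ-of m) M (invℕ m))
        (≡.trans (cong (_* M) (ℚ-of-inv k)) (*-identityˡ M)))
      (*-monoʳ-≤-nonNeg (invℕ m) {{nonNegative (invℕ≥0 m)}}
        (subst (_≤ ℚ-of m * M) (≡.trans (≡.sym (sum-jobs S)) (sum-↭ perm')) (Σ≤ (load S) (load≤makespan S))))
    largest : ithLargest 1 js ≤ M
    largest = ithLargest≤ 0 js M≥0 (subst (ℕ._≤ 0) (#above-↭ M perm')
      (ℕ.≤-trans (#above-jobs≤ M 0 S (λ j → ℕ.≤-reflexive (#above-none
        (All.map (λ h → ≤-trans h (load≤makespan S j)) (all-≤sum (S≥0 j))))))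
        (ℕ.≤-reflexive (ℕ.*-zeroʳ m))))
    one-big : ∀ j → #above (½ * M) (S j) ℕ.≤ 1
    one-big j with #above (½ * M) (S j) ℕ.≤? 1
    ... | yes h = h
    ... | no h = ⊥-elim (<-irrefl
      (solve 1 (λ M → con (ℚ-of 2) :* (con ½ :* M) := M) ≡.refl M)
      (<-≤-trans (#above*<sum 1 (S j) (lit ½ ⊛ M≥0) (ℕ.≰⇒> h)) (≤-trans (above-sum≤ (½ * M) (S≥0 j)) (load≤makespan S j))))
    twice : ℚ-of 2 * ithLargest (suc m) js ≤ M
    twice = subst (ℚ-of 2 * ithLargest (suc m) js ≤_)
      (solve 1 (λ M → con (ℚ-of 2) :* (con ½ :* M) := M) ≡.refl M)
      (*-monoˡ-≤-nonNeg (ℚ-of 2) (ithLargest≤ m js (lit ½ ⊛ M≥0)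
        (subst (ℕ._≤ m) (#above-↭ (½ * M) perm')
          (ℕ.≤-trans (#above-jobs≤ (½ * M) 1 S one-big) (ℕ.≤-reflexive (ℕ.*-identityʳ m))))))

  LB≥0 : ∀ m {js} → All (0ℚ ≤_) js → 0ℚ ≤ LB m js
  LB≥0 m {js} h = ≤-trans (sum≥0 h ⊛ invℕ≥0 m) (p≤p⊔q (sumℚ js * invℕ m) _)

  sum≤LB : ∀ {m} js → 0 ℕ.< m → sumℚ js ≤ ℚ-of m * LB m js
  sum≤LB {m} js (s≤s {n = k} _) = subst (_≤ ℚ-of m * LB m js)
    (≡.trans (solve 3 (λ a b c → a :* (b :* c) := a :* c :* b) ≡.refl (ℚ-of m) (sumℚ js) (invℕ m))
        (≡.trans (cong (_* sumℚ js) (ℚ-of-inv k)) (*-identityˡ (sumℚ js))))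
    (*-monoˡ-≤-nonNeg (ℚ-of m) {{nonNegative (ℚ-of≥0 m)}} (p≤p⊔q (sumℚ js * invℕ m) _))

  all≤LB : ∀ m js → All (_≤ LB m js) js
  all≤LB m js = #above≡0⇒All≤ js (#above≤ithLargest 0 js
    (≤-trans (p≤p⊔q (ithLargest 1 js) _) (p≤q⊔p (sumℚ js * invℕ m) _)))

  -- This is the third term of `LB` read backwards. It feeds the pigeonhole argument of the
  -- reassignment.
  #above-½LB≤ : ∀ m js → #above (½ * LB m js) js ℕ.≤ m
  #above-½LB≤ m js = #above≤ithLargest m js (subst (_≤ ½ * LB m js)
    (solve 1 (λ x → con ½ :* (con (ℚ-of 2) :* x) := x) ≡.refl (ithLargest (suc m) js))
    (*-monoˡ-≤-nonNeg ½ (≤-trans (p≤q⊔p (ithLargest 1 js) _) (p≤q⊔p (sumℚ js * invℕ m) _))))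

  LB-mono : ∀ m {js} ks → All (0ℚ ≤_) js → All (0ℚ ≤_) ks → LB m js ≤ LB m (js ++ ks)
  LB-mono m {js} ks hj hk = ⊔-mono-≤
    (*-monoʳ-≤-nonNeg (invℕ m) {{nonNegative (invℕ≥0 m)}} (≤-by {sumℚ js} (sum-++ js ks) (sum≥0 hk)))
    (⊔-mono-≤ (ithLargest-mono 0 ks hj hk) (*-monoˡ-≤-nonNeg (ℚ-of 2) (ithLargest-mono m ks hj hk)))

  -- Deleting a bounded number of jobs.

  -- Deleting the largest jobs first leaves the least load, so every Leave bounds from above what peelA and peelB keep.
  data Leave : ℕ → List ℚ → ℚ → Set where
    []   : ∀ {r} → Leave r [] 0ℚ
    keep : ∀ {r x xs s} → Leave r xs s → Leave r (x ∷ xs) (x + s)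
    del  : ∀ {r x xs s} → Leave r xs s → Leave (suc r) (x ∷ xs) s

  leave-weaken : ∀ {r r' xs s} → r ℕ.≤ r' → Leave r xs s → Leave r' xs s
  leave-weaken h [] = []
  leave-weaken h (keep l) = keep (leave-weaken h l)
  leave-weaken (s≤s h) (del l) = del (leave-weaken h l)

  leave-all : ∀ {r} xs → Leave r xs (sumℚ xs)
  leave-all [] = []
  leave-all (x ∷ xs) = keep (leave-all xs)

  leave-keep-last : ∀ {r xs s} p → Leave r xs s → Leave r (xs ∷ʳ p) (s + p)
  leave-keep-last p [] = subst (Leave _ (p ∷ [])) (+-comm p 0ℚ) (keep [])
  leave-keep-last p (keep {x = x} {s = s} l) = subst (Leave _ _) (≡.sym (+-assoc x s p)) (keep (leave-keep-last p l))
  leave-keep-last p (del l) = del (leave-keep-last p l)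

  leave-del-last : ∀ {r xs s} p → Leave r xs s → Leave (suc r) (xs ∷ʳ p) s
  leave-del-last p [] = del []
  leave-del-last p (keep l) = keep (leave-del-last p l)
  leave-del-last p (del l) = del (leave-del-last p l)

  leave-below : ∀ v xs → Leave (#above v xs) xs (sumℚ (below v xs))
  leave-below v [] = []
  leave-below v (x ∷ xs) with v <? x
  ... | yes h = ≡.subst₂ (λ r → Leave r (x ∷ xs)) (≡.sym (#above-∷ xs h)) (≡.sym (below-skip xs (<⇒≱ h)))
    (del (leave-below v xs))
  ... | no h = ≡.subst₂ (λ r → Leave r (x ∷ xs)) (≡.sym (#above-skip xs h)) (≡.sym (below-∷ xs (≮⇒≥ h)))
    (keep (leave-below v xs))

  leave-one : ∀ v xs → 1 ℕ.≤ #above v xs → ∃ λ s → Leave 1 xs s × v ≤ sumℚ xs - s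
  leave-one v (x ∷ xs) c with v <? x
  ... | yes h = sumℚ xs , del (leave-all xs) ,
    ≤-trans (<⇒≤ h) (≤-reflexive (solve 2 (λ x s → x := x :+ s :- s) ≡.refl x (sumℚ xs)))
  ... | no h with leave-one v xs (subst (1 ℕ.≤_) (#above-skip xs h) c)
  ... | s , l , e = x + s , keep l ,
    ≤-trans e (≤-reflexive (solve 3 (λ x s t → t :- s := x :+ t :- (x :+ s)) ≡.refl x s (sumℚ xs)))

  -- Either `x` is itself among the dropped jobs and the rest is unchanged, or `x` stays and a
  -- larger job is dropped in its place.
  drop-insert-del : ∀ r x ys → sumℚ (drop (suc r) (insertDesc x ys)) ≤ sumℚ (drop r ys)
  drop-insert-del zero x [] = ≤-refl
  drop-insert-del (suc r) x [] = ≤-refl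
  drop-insert-del r x (y ∷ ys) with y ≤? x
  ... | yes h = ≤-reflexive (cong (λ zs → sumℚ (drop (suc r) zs)) (insert-front ys h))
  drop-insert-del zero x (y ∷ ys) | no h = subst (_≤ y + sumℚ ys)
    (≡.trans (≡.sym (sum-↭ (insert-↭ x ys))) (cong (λ zs → sumℚ (drop 1 zs)) (≡.sym (insert-past ys h))))
    (+-monoˡ-≤ (sumℚ ys) (<⇒≤ (≰⇒> h)))
  drop-insert-del (suc r) x (y ∷ ys) | no h = subst (_≤ sumℚ (drop r ys))
    (cong (λ zs → sumℚ (drop (suc (suc r)) zs)) (≡.sym (insert-past ys h)))
    (drop-insert-del r x ys)

  sum-drop-[] : ∀ r → sumℚ (drop r []) ≡ 0ℚ
  sum-drop-[] zero = ≡.refl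
  sum-drop-[] (suc r) = ≡.refl

  drop-∷≤ : ∀ r {x y ys} → 0ℚ ≤ x → All (_≤ x) (y ∷ ys) → sumℚ (drop r (y ∷ ys)) ≤ x + sumℚ (drop r ys)
  drop-∷≤ zero {ys = ys} 0≤x (h ∷ _) = +-monoˡ-≤ (sumℚ ys) h
  drop-∷≤ (suc r) {x} {ys = []} 0≤x _ = subst (_≤ x + 0ℚ) (≡.sym (sum-drop-[] r)) (0≤x ⊕ ≤-refl)
  drop-∷≤ (suc r) {ys = y ∷ ys} 0≤x (_ ∷ h) = drop-∷≤ r 0≤x h

  drop-insert-keep : ∀ r x {ys} → 0ℚ ≤ x → Desc ys → sumℚ (drop r (insertDesc x ys)) ≤ x + sumℚ (drop r ys)
  drop-insert-keep zero x {ys} 0≤x d = ≤-reflexive (sum-↭ (insert-↭ x ys))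
  drop-insert-keep (suc r) x {[]} 0≤x d = subst (_≤ x + 0ℚ) (≡.sym (sum-drop-[] r)) (0≤x ⊕ ≤-refl)
  drop-insert-keep (suc r) x {y ∷ ys} 0≤x (h ∷ d) with y ≤? x
  ... | yes y≤x = subst (_≤ x + sumℚ (drop r ys)) (cong (λ zs → sumℚ (drop (suc r) zs)) (≡.sym (insert-front ys y≤x)))
    (drop-∷≤ r 0≤x (y≤x ∷ All.map (λ z≤y → ≤-trans z≤y y≤x) h))
  ... | no y≰x = subst (_≤ x + sumℚ (drop r ys)) (cong (λ zs → sumℚ (drop (suc r) zs)) (≡.sym (insert-past ys y≰x)))
    (drop-insert-keep r x 0≤x d)

  -- Optimality of greedy deletion, by induction on the `Leave` derivation: `keep` and `del` are
  -- matched by `drop-insert-keep` and `drop-insert-del`.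
  drop-sort≤ : ∀ {r xs s} → All (0ℚ ≤_) xs → Leave r xs s → sumℚ (drop r (sortDesc xs)) ≤ s
  drop-sort≤ {zero} _ [] = ≤-refl
  drop-sort≤ {suc r} _ [] = ≤-refl
  drop-sort≤ {r} {x ∷ xs} (h ∷ hs) (keep l) =
    ≤-trans (drop-insert-keep r x h (sort-desc xs)) (+-monoʳ-≤ x (drop-sort≤ hs l))
  drop-sort≤ {suc r} {x ∷ xs} (h ∷ hs) (del l) =
    ≤-trans (drop-insert-del r x (sortDesc xs)) (drop-sort≤ hs l)

  -- The removal procedures on one machine.

  module Peel (m : ℕ) (c : ℚ) where

    peelA-stop : ∀ {θ} x xs → sumℚ (x ∷ xs) ≤ θ → peelA m c θ (x ∷ xs) ≡ (x ∷ xs , [])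
    peelA-stop {θ} x xs h =
      cong (if_then (x ∷ xs , []) else (proj₁ (peelA m c θ xs) , x ∷ proj₂ (peelA m c θ xs)))
        (dec-true (sumℚ (x ∷ xs) ≤? θ) h)

    peelA-next : ∀ {θ} x xs → ¬ sumℚ (x ∷ xs) ≤ θ →
      peelA m c θ (x ∷ xs) ≡ (proj₁ (peelA m c θ xs) , x ∷ proj₂ (peelA m c θ xs))
    peelA-next {θ} x xs h =
      cong (if_then (x ∷ xs , []) else (proj₁ (peelA m c θ xs) , x ∷ proj₂ (peelA m c θ xs)))
        (dec-false (sumℚ (x ∷ xs) ≤? θ) h)

    -- The loop has stopped by the time `r` jobs are gone. Through `drop-sort≤`, any `Leave` witness
    -- therefore bounds the migrations from a machine of A.
    peelA-length : ∀ {θ} r xs → sumℚ (drop r xs) ≤ θ → length (proj₂ (peelA m c θ xs)) ℕ.≤ r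
    peelA-length r [] h = z≤n
    peelA-length {θ} r (x ∷ xs) h with sumℚ (x ∷ xs) ≤? θ
    ... | yes stop = subst (λ z → length (proj₂ z) ℕ.≤ r) (≡.sym (peelA-stop x xs stop)) z≤n
    peelA-length zero (x ∷ xs) h | no next = contradiction h next
    peelA-length (suc r) (x ∷ xs) h | no next =
      subst (λ z → length (proj₂ z) ℕ.≤ suc r) (≡.sym (peelA-next x xs next)) (s≤s (peelA-length r xs h))

    peelA-≤ : ∀ {θ} xs → 0ℚ ≤ θ → sumℚ (proj₁ (peelA m c θ xs)) ≤ θ
    peelA-≤ [] h = h
    peelA-≤ {θ} (x ∷ xs) h with sumℚ (x ∷ xs) ≤? θ
    ... | yes stop = subst (λ z → sumℚ (proj₁ z) ≤ θ) (≡.sym (peelA-stop x xs stop)) stop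
    ... | no next = subst (λ z → sumℚ (proj₁ z) ≤ θ) (≡.sym (peelA-next x xs next)) (peelA-≤ xs h)

    peelA-↭ : ∀ θ xs → proj₁ (peelA m c θ xs) ++ proj₂ (peelA m c θ xs) ↭ xs
    peelA-↭ θ [] = refl
    peelA-↭ θ (x ∷ xs) with sumℚ (x ∷ xs) ≤? θ
    ... | yes stop = subst (λ z → proj₁ z ++ proj₂ z ↭ x ∷ xs) (≡.sym (peelA-stop x xs stop))
      (↭-reflexive (++-identityʳ (x ∷ xs)))
    ... | no next = subst (λ z → proj₁ z ++ proj₂ z ↭ x ∷ xs) (≡.sym (peelA-next x xs next))
      (trans (shift x (proj₁ (peelA m c θ xs)) (proj₂ (peelA m c θ xs))) (prep x (peelA-↭ θ xs)))

    -- A removed job of size at most v leaves a load exceeding θ - v ≥ t.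
    peelA-> : ∀ {θ v t xs} → Desc xs → All (0ℚ ≤_) xs → t + v ≤ θ → t < sumℚ (below v xs) →
      t < sumℚ (proj₁ (peelA m c θ xs))
    peelA-> [] _ _ t< = t<
    peelA-> {θ} {v} {t} {x ∷ xs} (d ∷ ds) (h ∷ hs) tv t< with sumℚ (x ∷ xs) ≤? θ
    ... | yes stop = subst (λ z → t < sumℚ (proj₁ z)) (≡.sym (peelA-stop x xs stop)) (<-≤-trans t< (below-sum≤ v (h ∷ hs)))
    ... | no next = subst (λ z → t < sumℚ (proj₁ z)) (≡.sym (peelA-next x xs next)) (peelA-> ds hs tv rest)
      where
      rest : t < sumℚ (below v xs)
      rest with x ≤? v
      ... | no x≰v = subst (t <_) (below-skip xs x≰v) t<
      ... | yes x≤v = subst (t <_) (cong sumℚ (≡.sym (filter-all (_≤? v) (All.map (λ y≤x → ≤-trans y≤x x≤v) d))))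
        (<-cancelʳ (≤-<-trans tv (<-≤-trans (≰⇒> next)
          (≤-by (solve 3 (λ x v s → s :+ v := x :+ s :+ (v :- x)) ≡.refl x v (sumℚ xs)) (0≤-diff x≤v)))))
        where
        <-cancelʳ : ∀ {a b c} → a + c < b + c → a < b
        <-cancelʳ {a} {b} {c} h = ≡.subst₂ _<_ (lemma a c) (lemma b c) (+-monoˡ-< (- c) h)
          where
          lemma : ∀ a c → a + c - c ≡ a
          lemma = solve 2 (λ a c → a :+ c :- c := a) ≡.refl

    peelB-↭ : ∀ xs → proj₁ (peelB m c xs) ++ proj₂ (peelB m c xs) ↭ xs
    peelB-↭ [] = refl
    peelB-↭ (x ∷ xs) = ↭-sym (∷↭∷ʳ x xs)

    peelB-length : ∀ xs → length (proj₂ (peelB m c xs)) ℕ.≤ 1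
    peelB-length [] = z≤n
    peelB-length (x ∷ xs) = s≤s z≤n

    peelB-kept : ∀ xs → proj₁ (peelB m c xs) ≡ drop 1 xs
    peelB-kept [] = ≡.refl
    peelB-kept (x ∷ xs) = ≡.refl

    peel-A : ∀ L S {j} → InA m j → peel m c L S j ≡ peelA m c (cm1 m c * L) (sortDesc (S j))
    peel-A L S {j} h with toℕ j ℕ.<? ⌊ m /2⌋
    ... | yes _ = ≡.refl
    ... | no ¬h = contradiction h ¬h

    peel-B : ∀ L S {j} → InB m j → peel m c L S j ≡ peelB m c (sortDesc (S j))
    peel-B L S {j} h with toℕ j ℕ.<? ⌊ m /2⌋
    ... | yes h' = contradiction h (ℕ.<⇒≱ h')
    ... | no _ = ≡.refl

    peel-↭ : ∀ L S j → proj₁ (peel m c L S j) ++ proj₂ (peel m c L S j) ↭ S j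
    peel-↭ L S j with toℕ j ℕ.<? ⌊ m /2⌋
    ... | yes _ = trans (peelA-↭ (cm1 m c * L) (sortDesc (S j))) (sort-↭ (S j))
    ... | no _ = trans (peelB-↭ (sortDesc (S j))) (sort-↭ (S j))

  jobs-addJob : ∀ {m} (S : State m) j p → jobs (addJob S j p) ↭ p ∷ jobs S
  jobs-addJob {suc m} S zero p = ++⁺ʳ (jobs (S ∘ suc)) (↭-sym (∷↭∷ʳ p (S zero)))
  jobs-addJob {suc m} S (suc j) p = trans (↭-reflexive (cong (S zero ++_) (cong concat (tabulate-cong (λ j' → addJob-suc j')))))
    (trans (++⁺ˡ (S zero) (jobs-addJob (S ∘ suc) j p)) (shift p (S zero) (jobs (S ∘ suc))))
    where
    addJob-suc : ∀ j' → addJob S (suc j) p (suc j') ≡ addJob (S ∘ suc) j p j'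
    addJob-suc j' with j' ≟ j
    ... | yes ≡.refl = ≡.refl
    ... | no h = ≡.refl

  jobs-split : ∀ {m} (S k r : State m) → (∀ j → k j ++ r j ↭ S j) → jobs S ↭ jobs k ++ jobs r
  jobs-split {zero} S k r h = refl
  jobs-split {suc m} S k r h = trans (++⁺ (↭-sym (h zero)) (jobs-split (S ∘ suc) (k ∘ suc) (r ∘ suc) (h ∘ suc)))
    (trans (↭-reflexive (++-assoc (k zero) (r zero) _))
    (trans (++⁺ˡ (k zero) (shifts (r zero) (jobs (k ∘ suc))))
    (↭-reflexive (≡.sym (++-assoc (k zero) (jobs (k ∘ suc)) _)))))

  -- Deletions needed on a machine of A.

  ⅓ ⅔ : ℚ
  ⅓ = + 1 / 3
  ⅔ = + 2 / 3

  #above-antitone : ∀ {v w} → v ≤ w → ∀ xs → #above w xs ℕ.≤ #above v xs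
  #above-antitone v≤w [] = z≤n
  #above-antitone {v} {w} v≤w (x ∷ xs) with w <? x
  ... | yes h = ≡.subst₂ ℕ._≤_ (≡.sym (#above-∷ xs h)) (≡.sym (#above-∷ xs (≤-<-trans v≤w h))) (s≤s (#above-antitone v≤w xs))
  ... | no h = ℕ.≤-trans (ℕ.≤-reflexive (#above-skip xs h)) (ℕ.≤-trans (#above-antitone v≤w xs)
    (ℕ.≤-trans (ℕ.m≤n+m _ _) (ℕ.≤-reflexive (≡.sym (#above-++ v (x ∷ []) xs)))))

  below-monotone : ∀ {v w} → v ≤ w → ∀ {xs} → All (0ℚ ≤_) xs → sumℚ (below v xs) ≤ sumℚ (below w xs)
  below-monotone v≤w [] = ≤-refl
  below-monotone {v} {w} v≤w {x ∷ xs} (0≤x ∷ h) with x ≤? v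
  ... | yes x≤v = ≡.subst₂ _≤_ (≡.sym (below-∷ xs x≤v)) (≡.sym (below-∷ xs (≤-trans x≤v v≤w)))
    (+-monoʳ-≤ x (below-monotone v≤w h))
  ... | no x≰v with x ≤? w
  ... | yes x≤w = ≡.subst₂ _≤_ (≡.trans (+-identityˡ _) (≡.sym (below-skip xs x≰v))) (≡.sym (below-∷ xs x≤w))
    (+-mono-≤ 0≤x (below-monotone v≤w h))
  ... | no x≰w = ≡.subst₂ _≤_ (≡.sym (below-skip xs x≰v)) (≡.sym (below-skip xs x≰w)) (below-monotone v≤w h)

  above-antitone : ∀ {v w} → v ≤ w → ∀ {xs} → All (0ℚ ≤_) xs → sumℚ (above w xs) ≤ sumℚ (above v xs)
  above-antitone {v} {w} v≤w {xs} h = ≤-by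
    (≡.trans (solve 2 (λ a b → a := a :+ b :- b) ≡.refl (sumℚ (above v xs)) (sumℚ (below v xs)))
    (≡.trans (cong (_- sumℚ (below v xs)) (≡.trans (≡.sym (above+below v xs)) (above+below w xs)))
      (+-assoc (sumℚ (above w xs)) (sumℚ (below w xs)) (- sumℚ (below v xs)))))
    (0≤-diff (below-monotone v≤w h))

  Left : ℕ → List ℚ → ℚ → Set
  Left r xs θ = ∃ λ s → Leave r xs s × s ≤ θ

  left-≤ : ∀ {r xs θ θ'} → θ ≤ θ' → Left r xs θ → Left r xs θ'
  left-≤ h (s , l , e) = s , l , ≤-trans e h

  left-weaken : ∀ {r r' xs θ} → r ℕ.≤ r' → Left r xs θ → Left r' xs θ
  left-weaken h (s , l , e) = s , leave-weaken h l , e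

  left-del-last : ∀ {r xs θ} p → Left r xs θ → Left (suc r) (xs ∷ʳ p) θ
  left-del-last p (s , l , e) = s , leave-del-last p l , e

  Rel : ℕ → ℚ → List ℚ → Set
  Rel r c xs = Left r xs (c * sumℚ xs)

  -- A large arrival costs either kind of bound one more deletion. A relative bound also gains a
  -- factor 4/5, and once its factor is at most 1/2, `close` makes it absolute, because 1/2 of 4/3
  -- is 2/3.
  data Alt (r : ℕ) (c : ℚ) (xs : List ℚ) (L : ℚ) : Set where
    absolute : Left r xs (⅔ * L) → Alt r c xs L
    relative : Rel r c xs → Alt r c xs L

  _^_ : ℚ → ℕ → ℚ
  x ^ zero = 1ℚ
  x ^ suc n = x * x ^ n

  Geometric : ℕ → List ℚ → Set
  Geometric k xs = ∀ i → i ℕ.≤ k → Rel i ((+ 4 / 5) ^ i) xs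

  -- after-k: exactly k large jobs have arrived since the last small one (at least 4 for after-4+).
  data Phase (xs : List ℚ) (L : ℚ) : Set where
    after-0  : Left 5 xs (⅔ * L) → Alt 4 ½ xs L → Alt 1 (+ 9 / 10) xs L → Phase xs L
    after-1  : Left 6 xs (⅔ * L) → Alt 5 (+ 2 / 5) xs L → Alt 2 (+ 18 / 25) xs L → Geometric 1 xs → Phase xs L
    after-2  : Left 7 xs (⅔ * L) → Alt 6 (+ 8 / 25) xs L → Alt 3 (+ 72 / 125) xs L → Geometric 2 xs → Phase xs L
    after-3  : Left 7 xs (⅔ * L) → Alt 4 (+ 288 / 625) xs L → Geometric 3 xs → Phase xs L
    after-4+ : Left 5 xs (⅔ * L) → Geometric 4 xs → Phase xs L

  phase⇒left : ∀ {xs L} → Phase xs L → Left 7 xs (⅔ * L)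
  phase⇒left (after-0 l _ _) = left-weaken (ℕ.m≤m+n 5 2) l
  phase⇒left (after-1 l _ _ _) = left-weaken (ℕ.m≤m+n 6 1) l
  phase⇒left (after-2 l _ _ _) = l
  phase⇒left (after-3 l _ _) = l
  phase⇒left (after-4+ l _) = left-weaken (ℕ.m≤m+n 5 2) l

  module _ {L L'} (L≤L' : L ≤ L') where

    left-mono : ∀ {r xs} → Left r xs (⅔ * L) → Left r xs (⅔ * L')
    left-mono = left-≤ (*-monoˡ-≤-nonNeg ⅔ L≤L')

    alt-mono : ∀ {r c xs} → Alt r c xs L → Alt r c xs L'
    alt-mono (absolute l) = absolute (left-mono l)
    alt-mono (relative l) = relative l

    phase-mono : ∀ {xs} → Phase xs L → Phase xs L'
    phase-mono (after-0 l a b) = after-0 (left-mono l) (alt-mono a) (alt-mono b)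
    phase-mono (after-1 l a b g) = after-1 (left-mono l) (alt-mono a) (alt-mono b) g
    phase-mono (after-2 l a b g) = after-2 (left-mono l) (alt-mono a) (alt-mono b) g
    phase-mono (after-3 l a g) = after-3 (left-mono l) (alt-mono a) g
    phase-mono (after-4+ l g) = after-4+ (left-mono l) g

  -- A large job arriving at load X ≤ (4/3) L has size > L/3 ≥ X/4, so the old load is at most 4/5 of the new one.
  module LargeStep {xs L p} (xs≥0 : All (0ℚ ≤_) xs) (X≤ : sumℚ xs ≤ + 4 / 3 * L) (p> : ⅓ * L ≤ p) where

    rel-step : ∀ {r c} → 0ℚ ≤ c → Rel r c xs → Rel (suc r) (+ 4 / 5 * c) (xs ∷ʳ p)
    rel-step {r} {c} 0≤c l = left-≤ (≤-by
      (≡.trans (cong (+ 4 / 5 * c *_) (sum-∷ʳ xs p))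
        (solve 4 (λ c X p L → con (+ 4 / 5) :* c :* (X :+ p) :=
          c :* X :+ c :* (con (+ 1 / 5) :* ((con (+ 4 / 3) :* L :- X) :+ con (ℚ-of 4) :* (p :- con ⅓ :* L)))) ≡.refl c (sumℚ xs) p L))
      (0≤c ⊛ lit (+ 1 / 5) ⊛ (0≤-diff X≤ ⊕ lit (ℚ-of 4) ⊛ 0≤-diff p>)))
      (left-del-last p l)

    alt-step : ∀ {r c} → 0ℚ ≤ c → Alt r c xs L → Alt (suc r) (+ 4 / 5 * c) (xs ∷ʳ p) L
    alt-step 0≤c (absolute l) = absolute (left-del-last p l)
    alt-step 0≤c (relative l) = relative (rel-step 0≤c l)

    close : ∀ {r c} → c ≤ ½ → Alt r c xs L → Left (suc r) (xs ∷ʳ p) (⅔ * L)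
    close h (absolute l) = left-del-last p l
    close {r} {c} h (relative l) = left-≤ (≤-by
      (solve 3 (λ c X L → con ⅔ :* L := c :* X :+ ((con ½ :- c) :* X :+ con ½ :* (con (+ 4 / 3) :* L :- X))) ≡.refl c (sumℚ xs) L)
      (0≤-diff h ⊛ sum≥0 xs≥0 ⊕ lit ½ ⊛ 0≤-diff X≤))
      (left-del-last p l)

    ^≥0 : ∀ i → 0ℚ ≤ (+ 4 / 5) ^ i
    ^≥0 zero = lit 1ℚ
    ^≥0 (suc i) = lit (+ 4 / 5) ⊛ ^≥0 i

    rel-0 : ∀ ys → Rel 0 1ℚ ys
    rel-0 ys = sumℚ ys , leave-all ys , ≤-reflexive (≡.sym (*-identityˡ (sumℚ ys)))

    geometric-0 : Geometric 0 xs
    geometric-0 zero _ = rel-0 xs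

    geometric-step : ∀ {k} → Geometric k xs → Geometric (suc k) (xs ∷ʳ p)
    geometric-step g zero _ = rel-0 (xs ∷ʳ p)
    geometric-step g (suc i) (s≤s h) = rel-step (^≥0 i) (g i h)

    geometric-weaken : ∀ {k ys} → Geometric (suc k) ys → Geometric k ys
    geometric-weaken g i h = g i (ℕ.m≤n⇒m≤1+n h)

    lit≤ : ∀ {x y} {_ : True (x ≤? y)} → x ≤ y
    lit≤ {_} {_} {t} = toWitness t

    -- The `Alt` factors run through 1/2, 2/5, 8/25 and through 9/10, 18/25, 72/125, 288/625. The
    -- third large job closes the first track, giving 7 deletions where one more than the previous
    -- bound would be 8. The fourth closes the second track, as 288/625 < 1/2. From then on (4/5)^4
    -- = 256/625 < 1/2 suffices each time, so `Geometric` is kept at length 4.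
    phase-large : Phase xs L → Phase (xs ∷ʳ p) L
    phase-large (after-0 l a b) =
      after-1 (left-del-last p l) (alt-step (lit ½) a) (alt-step (lit (+ 9 / 10)) b) (geometric-step geometric-0)
    phase-large (after-1 l a b g) =
      after-2 (left-del-last p l) (alt-step (lit (+ 2 / 5)) a) (alt-step (lit (+ 18 / 25)) b) (geometric-step g)
    phase-large (after-2 l a b g) = after-3 (close lit≤ a) (alt-step (lit (+ 72 / 125)) b) (geometric-step g)
    phase-large (after-3 l a g) = after-4+ (close lit≤ a) (geometric-step g)
    phase-large (after-4+ l g) =
      after-4+ (close {c = (+ 4 / 5) ^ 4} lit≤ (relative (g 4 ℕ.≤-refl))) (geometric-weaken (geometric-step g))

  -- The first two fields let a small arrival rebuild `phase` from scratch. The constant 7/3 is 4/3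
  -- + 1: a large job of size at most L joins a load of at most (4/3) L.
  record Inv (xs : List ℚ) (L : ℚ) : Set where
    constructor inv
    field
      large-count : #above (⅓ * L) xs ℕ.≤ 4
      large-sum : sumℚ (above (⅓ * L) xs) ≤ + 7 / 3 * L
      phase : Phase xs L

  inv-mono : ∀ {xs L L'} → L ≤ L' → All (0ℚ ≤_) xs → Inv xs L → Inv xs L'
  inv-mono {xs} h xs≥0 (inv n s ph) = inv
    (ℕ.≤-trans (#above-antitone (*-monoˡ-≤-nonNeg ⅓ h) xs) n)
    (≤-trans (above-antitone (*-monoˡ-≤-nonNeg ⅓ h) xs≥0) (≤-trans s (*-monoˡ-≤-nonNeg (+ 7 / 3) h)))
    (phase-mono h ph)

  inv-[] : ∀ {L} → 0ℚ ≤ L → Inv [] L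
  inv-[] {L} h = inv z≤n (lit (+ 7 / 3) ⊛ h)
    (after-0 nothing (absolute nothing) (absolute nothing))
    where
    nothing : ∀ {r} → Left r [] (⅔ * L)
    nothing = 0ℚ , [] , lit ⅔ ⊛ h

  inv-large : ∀ {xs L p} → All (0ℚ ≤_) xs → 0ℚ ≤ L → sumℚ xs ≤ + 4 / 3 * L → ⅓ * L ≤ p → p ≤ L → Inv xs L →
    Inv (xs ∷ʳ p) L
  inv-large {xs} {L} {p} xs≥0 L≥0 X≤ p> p≤L (inv _ _ ph) = inv count
    (≤-trans (above-sum≤ (⅓ * L) (All.++⁺ xs≥0 (p≥0 ∷ [])))
      (≤-trans (≤-reflexive (sum-∷ʳ xs p)) (≤-by
        (solve 3 (λ X p L → con (+ 7 / 3) :* L := (X :+ p) :+ ((con (+ 4 / 3) :* L :- X) :+ (L :- p))) ≡.refl (sumℚ xs) p L)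
        (0≤-diff X≤ ⊕ 0≤-diff p≤L))))
    (LargeStep.phase-large xs≥0 X≤ p> ph)
    where
    p≥0 : 0ℚ ≤ p
    p≥0 = ≤-trans (lit ⅓ ⊛ L≥0) p>
    -- Four jobs above L/3 would already outweigh the load (4/3) L that `p` meets.
    few : #above (⅓ * L) xs ℕ.≤ 3
    few with #above (⅓ * L) xs ℕ.≤? 3
    ... | yes h = h
    ... | no h = ⊥-elim (<⇒≱ (#above*<sum 3 xs (lit ⅓ ⊛ L≥0) (ℕ.≰⇒> h)) (≤-trans (above-sum≤ (⅓ * L) xs≥0)
      (≤-trans X≤ (≤-reflexive (solve 1 (λ L → con (+ 4 / 3) :* L := con (ℚ-of 4) :* (con ⅓ :* L)) ≡.refl L)))))
    count : #above (⅓ * L) (xs ∷ʳ p) ℕ.≤ 4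
    count = ℕ.≤-trans (ℕ.≤-reflexive (#above-++ (⅓ * L) xs (p ∷ []))) (ℕ.+-mono-≤ few (length-filter ((⅓ * L) <?_) (p ∷ [])))

  inv-small : ∀ {xs L p} → All (0ℚ ≤_) xs → 0ℚ ≤ L → sumℚ (below (⅓ * L) xs) ≤ ⅔ * L → 0ℚ ≤ p → p ≤ ⅓ * L →
    Inv xs L → Inv (xs ∷ʳ p) L
  inv-small {xs} {L} {p} xs≥0 L≥0 S≤ p≥0 p≤ (inv n s _) = inv
    (subst (λ ys → length ys ℕ.≤ 4) same n)
    (subst (λ ys → sumℚ ys ≤ + 7 / 3 * L) same s)
    (after-0 (left-del-last p (left-weaken n smalls)) alt-4 alt-1)
    where
    v = ⅓ * L
    G = sumℚ (above v xs)
    S = sumℚ (below v xs)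
    same : above v xs ≡ above v (xs ∷ʳ p)
    same = ≡.sym (≡.trans (filter-++ (v <?_) xs (p ∷ []))
      (≡.trans (cong (above v xs ++_) (filter-none (v <?_) ((λ h → <⇒≱ h p≤) ∷ []))) (++-identityʳ (above v xs))))
    smalls : Left (#above v xs) xs (⅔ * L)
    smalls = S , leave-below v xs , S≤
    total : sumℚ (xs ∷ʳ p) ≡ G + S + p
    total = ≡.trans (sum-∷ʳ xs p) (cong (_+ p) (above+below v xs))
    -- With at most three jobs above L/3, delete those and `p`. With four, delete just these: they
    -- weigh G > (4/3) L, while what stays is S + p ≤ L, less than half of the total.
    alt-4 : Alt 4 ½ (xs ∷ʳ p) L
    alt-4 with #above v xs ℕ.≤? 3
    ... | yes h = absolute (left-del-last p (left-weaken h smalls))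
    ... | no h = relative (S + p , leave-weaken n (leave-keep-last p (leave-below v xs)) , ≤-by
      (≡.trans (cong (½ *_) total) (solve 4 (λ G S p L → con ½ :* (G :+ S :+ p) := (S :+ p) :+
        con ½ :* ((G :- con (ℚ-of 4) :* (con ⅓ :* L)) :+ (con ⅔ :* L :- S) :+ (con ⅓ :* L :- p) :+ con ⅓ :* L)) ≡.refl G S p L))
      (lit ½ ⊛ (0≤-diff (<⇒≤ (#above*<sum 3 xs (lit ⅓ ⊛ L≥0) (ℕ.≰⇒> h))) ⊕ 0≤-diff S≤ ⊕ 0≤-diff p≤ ⊕ lit ⅓ ⊛ L≥0)))
    -- If some job exceeds L/3, it is at least a tenth of the load, which is at most (7/3 + 2/3 +
    -- 1/3) L = (10/3) L.
    alt-1 : Alt 1 (+ 9 / 10) (xs ∷ʳ p) L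
    alt-1 with #above v xs ℕ.≤? 0
    ... | yes h = absolute (left-del-last p (left-weaken h smalls))
    ... | no h with leave-one v xs (ℕ.≰⇒> h)
    ... | t , l , e = relative (t + p , leave-keep-last p l , ≤-by
      (≡.trans (cong (+ 9 / 10 *_) total) (solve 5 (λ G S p L t → con (+ 9 / 10) :* (G :+ S :+ p) := (t :+ p) :+
        ((G :+ S :- t :- con ⅓ :* L) :+ con (+ 1 / 10) :* ((con (+ 7 / 3) :* L :- G) :+ (con ⅔ :* L :- S) :+ (con ⅓ :* L :- p))))
        ≡.refl G S p L t))
      (0≤-diff (subst (λ X → v ≤ X - t) (above+below v xs) e) ⊕ lit (+ 1 / 10) ⊛ (0≤-diff s ⊕ 0≤-diff S≤ ⊕ 0≤-diff p≤)))

  -- Sizes of A and B, and averaging over the machines.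

  ⌈n/2⌉≤1+⌊n/2⌋ : ∀ n → ℕ.⌈ n /2⌉ ℕ.≤ suc ⌊ n /2⌋
  ⌈n/2⌉≤1+⌊n/2⌋ zero = z≤n
  ⌈n/2⌉≤1+⌊n/2⌋ (suc zero) = ℕ.≤-refl
  ⌈n/2⌉≤1+⌊n/2⌋ (suc (suc n)) = s≤s (⌈n/2⌉≤1+⌊n/2⌋ n)

  n∸⌊n/2⌋ : ∀ n → n ∸ ⌊ n /2⌋ ≡ ℕ.⌈ n /2⌉
  n∸⌊n/2⌋ n = ≡.trans (cong (_∸ ⌊ n /2⌋) (≡.sym (ℕ.⌊n/2⌋+⌈n/2⌉≡n n))) (ℕ.m+n∸m≡n ⌊ n /2⌋ ℕ.⌈ n /2⌉)

  infixl 6 _⊕<_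
  _⊕<_ : ∀ {x y} → 0ℚ < x → 0ℚ ≤ y → 0ℚ < x + y
  _⊕<_ = +-mono-<-≤

  infixr 7 _⊛<_
  _⊛<_ : ∀ {x y} → 0ℚ < x → 0ℚ < y → 0ℚ < x * y
  _⊛<_ {x} {y} hx hy = subst (_< x * y) (*-zeroʳ x) (*-monoʳ-<-pos x {{positive hx}} hy)

  module Machines (m : ℕ) (2≤m : 2 ℕ.≤ m) where

    #A #B : ℚ
    #A = ℚ-of ⌊ m /2⌋
    #B = ℚ-of (m ∸ ⌊ m /2⌋)

    0<m : 0 ℕ.< m
    0<m = ℕ.≤-trans (s≤s z≤n) 2≤m

    #A≥0 : 0ℚ ≤ #A
    #A≥0 = ℚ-of≥0 ⌊ m /2⌋

    #A≤#B : #A ≤ #B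
    #A≤#B = ℚ-of-mono (ℕ.≤-trans (ℕ.⌊n/2⌋≤⌈n/2⌉ m) (ℕ.≤-reflexive (≡.sym (n∸⌊n/2⌋ m))))

    #B≤1+#A : #B ≤ 1ℚ + #A
    #B≤1+#A = ≤-trans
      (ℚ-of-mono (ℕ.≤-trans (ℕ.≤-reflexive (n∸⌊n/2⌋ m)) (⌈n/2⌉≤1+⌊n/2⌋ m)))
      (≤-reflexive (ℚ-of-+ 1 ⌊ m /2⌋))

    #B>0 : 0ℚ < #B
    #B>0 = <-≤-trans (positive⁻¹ 1ℚ) (≤-trans (ℚ-of-mono {1} (ℕ.⌊n/2⌋-mono 2≤m)) #A≤#B)

    #A+#B : ℚ-of m ≡ #A + #B
    #A+#B = ≡.trans (cong ℚ-of (≡.sym (ℕ.m+[n∸m]≡n (ℕ.⌊n/2⌋≤n m)))) (ℚ-of-+ ⌊ m /2⌋ (m ∸ ⌊ m /2⌋))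

    inA? : ∀ j → InA m j ⊎ InB m j
    inA? j with toℕ j ℕ.<? ⌊ m /2⌋
    ... | yes h = inj₁ h
    ... | no h = inj₂ (ℕ.≮⇒≥ h)

    -- The averaging estimate behind every overload contradiction: assigned jobs, the current job
    -- `p` and the pending `ps` together weigh at most m L. It is stated as a nonnegative difference
    -- so as to serve as a summand in `⊥-by`.
    sum-slack : ∀ {L α β p ps js} (S : State m) → jobs S ++ p ∷ ps ↭ js → All (0ℚ ≤_) ps → sumℚ js ≤ ℚ-of m * L →
      (∀ j → InA m j → α ≤ load S j) → (∀ j → InB m j → β ≤ load S j) →
      0ℚ ≤ (#A + #B) * L - (#A * α + #B * β + p)
    sum-slack {L} {α} {β} {p} {ps} {js} S perm ps≥0 avg hα hβ = 0≤-diff (≤-trans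
      (≤-trans (+-monoˡ-≤ p (Σ-split≥ ⌊ m /2⌋ (load S) (ℕ.⌊n/2⌋≤n m) hα hβ))
        (≤-by (≡.trans (≡.sym (sum-↭ perm)) (≡.trans (sum-++ (jobs S) (p ∷ ps))
          (≡.trans (cong (_+ (p + sumℚ ps)) (sum-jobs S)) (≡.sym (+-assoc (Σ (load S)) p (sumℚ ps)))))) (sum≥0 ps≥0)))
      (subst (λ z → sumℚ js ≤ z * L) #A+#B avg))

  -- At this value `δ`, `cm1` and `3mc` evaluate to 1/3, 2/3 and 4/3, so the tests of the algorithm
  -- agree definitionally with the bounds stated in `⅓`, `⅔` and `+ 4 / 3`.
  c : ℚ
  c = + 5 / 3

  -- Invariants of the arrival phase.

  module Arrival (m : ℕ) (2≤m : 2 ℕ.≤ m) where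

    open Machines m 2≤m

    -- The load s met by a job entering B: at most (2/3) L, or the job was small and came at a time with bound σ,
    -- when every machine of A carried small load above (2/3) σ.
    LowOrFilled : State m → ℚ → ℚ → Set
    LowOrFilled S L s = s ≤ ⅔ * L ⊎
      ∃ λ σ → σ ≤ L × s ≤ + 4 / 3 * σ × (∀ j' → InA m j' → ⅔ * σ < sumℚ (below (⅓ * σ) (S j')))

    -- On a nonempty machine the deleted job is the last arrival and `s` the load it met. Removing
    -- the largest job instead leaves no more, by `drop-sort≤`.
    BInv : State m → ℚ → Fin m → Set
    BInv S L j = ∃ λ s → Leave 1 (S j) s × LowOrFilled S L s

    record ArrivalInv (prefix : List ℚ) (S : State m) : Set where
      constructor arrivalInv
      field
        prefix≥0 : All (0ℚ ≤_) prefix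
        perm : jobs S ↭ prefix
        invA : ∀ j → InA m j → Inv (S j) (LB m prefix)
        invB : ∀ j → InB m j → BInv S (LB m prefix) j

    module Step {prefix S p j} (I : ArrivalInv prefix S) (p≥0 : 0ℚ ≤ p)
      (choice : ArrivalChoice m c S p (LB m (prefix ∷ʳ p)) j) where

      open ArrivalInv I

      L L' : ℚ
      L = LB m prefix
      L' = LB m (prefix ∷ʳ p)

      prefix'≥0 : All (0ℚ ≤_) (prefix ∷ʳ p)
      prefix'≥0 = All.++⁺ prefix≥0 (p≥0 ∷ [])

      L≤L' : L ≤ L'
      L≤L' = LB-mono m (p ∷ []) prefix≥0 (p≥0 ∷ [])

      L'≥0 : 0ℚ ≤ L'
      L'≥0 = LB≥0 m prefix'≥0

      p≤L' : p ≤ L'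
      p≤L' = All.head (All.++⁻ʳ prefix (all≤LB m (prefix ∷ʳ p)))

      S≥0 : ∀ j → All (0ℚ ≤_) (S j)
      S≥0 = jobs-All S (All-resp-↭ (↭-sym perm) prefix≥0)

      S' : State m
      S' = addJob S j p

      perm' : jobs S' ↭ prefix ∷ʳ p
      perm' = trans (jobs-addJob S j p) (trans (prep p perm) (∷↭∷ʳ p prefix))

      slack : ∀ {α β} → (∀ j → InA m j → α ≤ load S j) → (∀ j → InB m j → β ≤ load S j) →
        0ℚ ≤ (#A + #B) * L' - (#A * α + #B * β + p)
      slack = sum-slack {ps = []} S (++⁺ʳ (p ∷ []) perm) [] (sum≤LB (prefix ∷ʳ p) 0<m)

      below-grows : ∀ v j' → sumℚ (below v (S j')) ≤ sumℚ (below v (S' j'))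
      below-grows v j' with j' ≟ j
      ... | no _ = ≤-refl
      ... | yes _ = ≤-by
        (≡.trans (cong sumℚ (filter-++ (_≤? v) (S j') (p ∷ []))) (sum-++ (below v (S j')) (below v (p ∷ []))))
        (sum≥0 (All.filter⁺ (_≤? v) (p≥0 ∷ [])))

      -- Loads above 2/3 on A and above 4/3 on B, in units of `L'`, would average above 1, because B
      -- has at least as many machines as A.
      small-B-load : (∀ j' → InA m j' → ⅔ * L' < sumℚ (below (⅓ * L') (S j'))) →
        (∀ j' → InB m j' → load S j ≤ load S j') → load S j ≤ + 4 / 3 * L'
      small-B-load full least with load S j ≤? + 4 / 3 * L'
      ... | yes h = h
      ... | no h = ⊥-elim (⊥-by
        (solve 5 (λ a b x l p → b :* (x :- con (+ 4 / 3) :* l) :+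
           ((a :+ b) :* l :- (a :* (con ⅔ :* l) :+ b :* x :+ p)) :+ con ⅓ :* ((b :- a) :* l) :+ p := con 0ℚ)
           ≡.refl #A #B (load S j) L' p)
        (#B>0 ⊛< 0<-diff (≰⇒> h)
          ⊕< slack (λ j' i → ≤-trans (<⇒≤ (full j' i)) (below-sum≤ (⅓ * L') (S≥0 j'))) least
          ⊕< lit ⅓ ⊛ 0≤-diff #A≤#B ⊛ L'≥0
          ⊕< p≥0))

      -- Here A carries the surplus of 1/3 per machine and B the deficit. B may have one machine
      -- more than A, and the job `p` itself pays for that one.
      large-B-load : ⅓ * L' ≤ p → (∀ j' → InA m j' → + 4 / 3 * L' < load S j') →
        (∀ j' → InB m j' → load S j ≤ load S j') → load S j ≤ ⅔ * L'
      large-B-load large full least with load S j ≤? ⅔ * L'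
      ... | yes h = h
      ... | no h = ⊥-elim (⊥-by
        (solve 5 (λ a b x l p → b :* (x :- con ⅔ :* l) :+
           ((a :+ b) :* l :- (a :* (con (+ 4 / 3) :* l) :+ b :* x :+ p)) :+
           (p :- con ⅓ :* l) :+ con ⅓ :* ((con 1ℚ :+ a :- b) :* l) := con 0ℚ)
           ≡.refl #A #B (load S j) L' p)
        (#B>0 ⊛< 0<-diff (≰⇒> h)
          ⊕< slack (λ j' i → <⇒≤ (full j' i)) least
          ⊕< 0≤-diff large
          ⊕< lit ⅓ ⊛ 0≤-diff #B≤1+#A ⊛ L'≥0))

      stepA : ArrivalChoice m c S p L' j → InA m j → Inv (S j) L' → Inv (S j ∷ʳ p) L'
      stepA (small-A small _ room _) a v = inv-small (S≥0 j) L'≥0 room p≥0 small v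
      stepA (large-A large (j₀ , inA , room) _ least) a v =
        inv-large (S≥0 j) L'≥0 (≤-trans (least j₀ inA) room) (<⇒≤ (≰⇒> large)) p≤L' v
      stepA (small-B _ _ b _) a v = contradiction b (ℕ.<⇒≱ a)
      stepA (large-B _ _ b _) a v = contradiction b (ℕ.<⇒≱ a)

      stepB : ArrivalChoice m c S p L' j → InB m j → LowOrFilled S' L' (load S j)
      stepB (small-B small full _ least) b = inj₂ (L' , ≤-refl , small-B-load (λ j' i → ≰⇒> (full j' i)) least ,
        λ j' i → <-≤-trans (≰⇒> (full j' i)) (below-grows (⅓ * L') j'))
      stepB (large-B large full _ least) b = inj₁ (large-B-load (<⇒≤ (≰⇒> large)) (λ j' i → ≰⇒> (full j' i)) least)
      stepB (small-A _ a _ _) b = contradiction b (ℕ.<⇒≱ a)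
      stepB (large-A _ _ a _) b = contradiction b (ℕ.<⇒≱ a)

      invA' : ∀ j' → InA m j' → Inv (S' j') L'
      invA' j' a with j' ≟ j
      ... | yes ≡.refl = stepA choice a (inv-mono L≤L' (S≥0 j) (invA j a))
      ... | no _ = inv-mono L≤L' (S≥0 j') (invA j' a)

      invB' : ∀ j' → InB m j' → BInv S' L' j'
      invB' j' b with j' ≟ j
      ... | yes ≡.refl = load S j , leave-del-last p (leave-all (S j)) , stepB choice b
      ... | no _ with invB j' b
      ... | s , l , e = s , l , grow e
        where
        grow : LowOrFilled S L s → LowOrFilled S' L' s
        grow (inj₁ e) = inj₁ (≤-trans e (*-monoˡ-≤-nonNeg ⅔ L≤L'))
        grow (inj₂ (σ , σ≤ , e , f)) = inj₂ (σ , ≤-trans σ≤ L≤L' , e , λ j' i → <-≤-trans (f j' i) (below-grows (⅓ * σ) j'))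

      next : ArrivalInv (prefix ∷ʳ p) S'
      next = arrivalInv prefix'≥0 perm' invA' invB'

    arrivals : ∀ {prefix S rest S'} → ArrivalInv prefix S → All (0ℚ ≤_) rest → Arrivals m c prefix S rest S' →
      ArrivalInv (prefix ++ rest) S'
    arrivals {prefix} I _ done = subst (λ ps → ArrivalInv ps _) (≡.sym (++-identityʳ prefix)) I
    arrivals {prefix} {rest = p ∷ rest} I (h ∷ hs) (step choice steps) =
      subst (λ ps → ArrivalInv ps _) (++-assoc prefix (p ∷ []) rest) (arrivals (Step.next I h choice) hs steps)

    initial : ArrivalInv [] empty
    initial = arrivalInv [] (↭-reflexive (no-jobs m)) (λ j _ → inv-[] (LB≥0 m []))
      (λ j _ → 0ℚ , [] , inj₁ (lit ⅔ ⊛ LB≥0 m []))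
      where
      no-jobs : ∀ m → jobs {m} empty ≡ []
      no-jobs zero = ≡.refl
      no-jobs (suc m) = no-jobs m

    -- Migrations, and loads after the removal.

    module Removal {js S} (I : ArrivalInv js S) where

      open ArrivalInv I
      open Peel m c

      L : ℚ
      L = LB m js

      L≥0 : 0ℚ ≤ L
      L≥0 = LB≥0 m prefix≥0

      S≥0 : ∀ j → All (0ℚ ≤_) (S j)
      S≥0 = jobs-All S (All-resp-↭ (↭-sym perm) prefix≥0)

      T : State m
      T = afterRemoval m c L S

      R : List ℚ
      R = removed m c L S

      R≡jobs : R ≡ jobs (λ j → proj₂ (peel m c L S j))
      R≡jobs = allFin-jobs (λ j → proj₂ (peel m c L S j))

      kept+removed : jobs T ++ sortDesc R ↭ js
      kept+removed = trans (++⁺ˡ (jobs T) (trans (sort-↭ R) (↭-reflexive R≡jobs)))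
        (trans (↭-sym (jobs-split S T (λ j → proj₂ (peel m c L S j)) (peel-↭ L S))) perm)

      few-removed-A : ∀ j → InA m j → length (proj₂ (peel m c L S j)) ℕ.≤ 7
      few-removed-A j a with phase⇒left (Inv.phase (invA j a))
      ... | s , l , e = subst (λ z → length (proj₂ z) ℕ.≤ 7) (≡.sym (peel-A L S a))
        (peelA-length 7 (sortDesc (S j)) (≤-trans (drop-sort≤ (S≥0 j) l) e))

      few-removed-B : ∀ j → InB m j → length (proj₂ (peel m c L S j)) ℕ.≤ 1
      few-removed-B j b = subst (λ z → length (proj₂ z) ℕ.≤ 1) (≡.sym (peel-B L S b)) (peelB-length (sortDesc (S j)))

      -- With a ≤ b, 7a + b = 4a + (3a + b) ≤ 4a + 4b.
      few-removed : length R ℕ.≤ 4 ℕ.* m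
      few-removed = subst (λ z → length z ℕ.≤ 4 ℕ.* m) (≡.sym R≡jobs)
        (ℕ.≤-trans (length-jobs≤ a (λ j → proj₂ (peel m c L S j)) (ℕ.⌊n/2⌋≤n m) few-removed-A few-removed-B)
        (ℕ.≤-trans (ℕ.≤-reflexive (ℕ-solve 2
          (λ a b → a ℕ:* ℕcon 7 ℕ:+ b ℕ:* ℕcon 1 ℕ:= ℕcon 4 ℕ:* a ℕ:+ (ℕcon 3 ℕ:* a ℕ:+ b)) ≡.refl a b))
        (ℕ.≤-trans (ℕ.+-monoʳ-≤ (4 ℕ.* a) (ℕ.+-monoˡ-≤ b (ℕ.*-monoʳ-≤ 3 a≤b)))
        (ℕ.≤-reflexive (≡.trans
          (ℕ-solve 2 (λ a b → ℕcon 4 ℕ:* a ℕ:+ (ℕcon 3 ℕ:* b ℕ:+ b) ℕ:= ℕcon 4 ℕ:* (a ℕ:+ b)) ≡.refl a b)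
          (cong (4 ℕ.*_) (ℕ.m+[n∸m]≡n (ℕ.⌊n/2⌋≤n m))))))))
        where
        a = ⌊ m /2⌋
        b = m ∸ ⌊ m /2⌋
        a≤b : a ℕ.≤ b
        a≤b = ℕ.≤-trans (ℕ.⌊n/2⌋≤⌈n/2⌉ m) (ℕ.≤-reflexive (≡.sym (n∸⌊n/2⌋ m)))

      load-A≤ : ∀ j → InA m j → load T j ≤ ⅔ * L
      load-A≤ j a = subst (λ z → sumℚ (proj₁ z) ≤ ⅔ * L) (≡.sym (peel-A L S a)) (peelA-≤ (sortDesc (S j)) (lit ⅔ ⊛ L≥0))

      load-B : ∀ j → InB m j → load T j ≤ + 4 / 3 * L × (load T j ≤ ⅔ * L ⊎ (∀ j' → InA m j' → ⅓ * L < load T j'))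
      load-B j b with invB j b
      ... | s , l , e = cases e
        where
        T≤s : load T j ≤ s
        T≤s = subst (_≤ s) (cong sumℚ (≡.trans (≡.sym (peelB-kept (sortDesc (S j)))) (≡.sym (cong proj₁ (peel-B L S b)))))
          (drop-sort≤ (S≥0 j) l)
        -- `peelA->` is applied with t = L/3 and v = σ/3: σ ≤ L gives t + v ≤ (2/3) L, and σ ≥ L/2
        -- puts the small load above (2/3) σ ≥ t.
        A-kept : ∀ {σ} → σ ≤ L → ½ * L ≤ σ → ∀ j' → ⅔ * σ < sumℚ (below (⅓ * σ) (S j')) → InA m j' → ⅓ * L < load T j'
        A-kept {σ} σ≤ ≤σ j' full a = subst (λ z → ⅓ * L < sumℚ (proj₁ z)) (≡.sym (peel-A L S a))
          (peelA-> (sort-desc (S j')) (All-resp-↭ (↭-sym (sort-↭ (S j'))) (S≥0 j'))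
            (≤-by (solve 2 (λ l s → con ⅔ :* l := con ⅓ :* l :+ con ⅓ :* s :+ con ⅓ :* (l :- s)) ≡.refl L σ)
              (lit ⅓ ⊛ 0≤-diff σ≤))
            (≤-<-trans (≤-by (solve 2 (λ l s → con ⅔ :* s := con ⅓ :* l :+ con ⅔ :* (s :- con ½ :* l)) ≡.refl L σ)
                (lit ⅔ ⊛ 0≤-diff ≤σ))
              (subst (⅔ * σ <_) (≡.sym (sum-↭ (filter-↭ (_≤? (⅓ * σ)) (sort-↭ (S j'))))) full)))
        cases : LowOrFilled S L s →
          load T j ≤ + 4 / 3 * L × (load T j ≤ ⅔ * L ⊎ (∀ j' → InA m j' → ⅓ * L < load T j'))
        cases (inj₁ e) =
          ≤-trans T≤s (≤-trans e (*-monoʳ-≤-nonNeg L {{nonNegative L≥0}} (≤-by {⅔} {+ 4 / 3} ≡.refl (lit ⅔)))) ,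
          inj₁ (≤-trans T≤s e)
        cases (inj₂ (σ , σ≤ , e , full)) = ≤-trans T≤s (≤-trans e (*-monoˡ-≤-nonNeg (+ 4 / 3) σ≤)) , second
          where
          second : load T j ≤ ⅔ * L ⊎ (∀ j' → InA m j' → ⅓ * L < load T j')
          -- For σ below L/2 the bound (4/3) σ is already under (2/3) L; otherwise `A-kept` applies.
          second with ½ * L ≤? σ
          ... | yes h = inj₂ (λ j' a → A-kept σ≤ h j' (full j' a) a)
          ... | no h = inj₁ (≤-trans T≤s (≤-trans e (≤-by
            (solve 2 (λ l s → con ⅔ :* l := con (+ 4 / 3) :* s :+ con (+ 4 / 3) :* (con ½ :* l :- s)) ≡.refl L σ)
            (lit (+ 4 / 3) ⊛ 0≤-diff (<⇒≤ (≰⇒> h))))))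

  -- The reassignment.

  -- If every machine occurred in `us`, `index` would inject `Fin m` into the shorter
  -- `Fin (length us)`.
  untouched : ∀ {m} (us : List (Fin m)) → length us ℕ.< m → ∃ λ j → ¬ j ∈ us
  untouched {m} us short = Fin.¬∀⟶∃¬ m (_∈ us) (λ j → any? (j ≟_) us) λ every →
    let (i , j , i<j , same) = Fin.pigeonhole short (λ j → index (every j))
    in Fin.<-irrefl (≡.trans (lookup-index (every i)) (≡.trans (cong (lookup us) same) (≡.sym (lookup-index (every j))))) i<j

  module Reassignment (m : ℕ) (2≤m : 2 ℕ.≤ m) {js : List ℚ} (js>0 : All (0ℚ <_) js) (T₀ : State m)
    (load-A : ∀ j → InA m j → load T₀ j ≤ ⅔ * LB m js)
    (load-B : ∀ j → InB m j → load T₀ j ≤ ⅔ * LB m js ⊎ (∀ j' → InA m j' → ⅓ * LB m js < load T₀ j')) where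

    open Machines m 2≤m

    L : ℚ
    L = LB m js

    -- In the second case `q` is a job that the machine received. Jobs come in non-increasing order,
    -- so `q` dominates everything pending, and this persists as `rest` shrinks.
    Status : State m → List ℚ → List (Fin m) → Fin m → Set
    Status T rest us j = load T j ≡ load T₀ j ⊎ (j ∈ us × ∃ λ q → All (_≤ q) rest × load T₀ j + q ≤ load T j)

    -- us: the machines that have received reassigned jobs, one entry per job.
    record ReassignInv (T : State m) (rest : List ℚ) (us : List (Fin m)) : Set where
      constructor reassignInv
      field
        perm : jobs T ++ rest ↭ js
        desc : Desc rest
        count : ∀ v → 1 ℕ.≤ #above v rest → length us ℕ.+ #above v rest ℕ.≤ #above v js
        bounded : ∀ j → load T j ≤ c * L
        status : ∀ j → Status T rest us j

    module Step {T p rest us} (I : ReassignInv T (p ∷ rest) us) where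

      open ReassignInv I

      all>0 : All (0ℚ <_) (jobs T ++ p ∷ rest)
      all>0 = All-resp-↭ (↭-sym perm) js>0

      p>0 : 0ℚ < p
      p>0 = All.head (All.++⁻ʳ (jobs T) all>0)

      rest≥0 : All (0ℚ ≤_) rest
      rest≥0 = All.map <⇒≤ (All.tail (All.++⁻ʳ (jobs T) all>0))

      p≤L : p ≤ L
      p≤L = All.head (All.++⁻ʳ (jobs T) (All-resp-↭ (↭-sym perm) (all≤LB m js)))

      slack : ∀ {α β} → (∀ j → InA m j → α ≤ load T j) → (∀ j → InB m j → β ≤ load T j) →
        0ℚ ≤ (#A + #B) * L - (#A * α + #B * β + p)
      slack = sum-slack T perm rest≥0 (sum≤LB js 0<m)

      #above-head : ∀ {v} → v < p → 1 ℕ.≤ #above v (p ∷ rest)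
      #above-head {v} h = subst (1 ℕ.≤_) (≡.sym (#above-∷ rest h)) (s≤s z≤n)

      -- The jobs already reassigned and `p` all exceed L/2, so by `count` there are at most m of
      -- them, and fewer than m without `p`.
      free-machine : ½ * L < p → ∃ λ j → ¬ j ∈ us
      free-machine h = untouched us (ℕ.<-≤-trans
        (ℕ.≤-trans (ℕ.≤-reflexive (ℕ.+-comm 1 (length us))) (ℕ.+-monoʳ-≤ (length us) (#above-head h)))
        (ℕ.≤-trans (count (½ * L) (#above-head h)) (#above-½LB≤ m js)))

      module Full (full : ∀ j → c * L - p < load T j) where

        -- Otherwise each load exceeds (5/3) L - p ≥ L, so the assigned jobs alone fill m L and
        -- there is no room for `p`.
        not-small : ¬ p ≤ ⅔ * L
        not-small h = ⊥-by
          (solve 4 (λ a b l p → p :+ ((a :+ b) :* l :- (a :* (con c :* l :- p) :+ b :* (con c :* l :- p) :+ p)) :+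
             (a :+ b) :* (con ⅔ :* l :- p) := con 0ℚ) ≡.refl #A #B L p)
          (p>0 ⊕< slack (λ j _ → <⇒≤ (full j)) (λ j _ → <⇒≤ (full j)) ⊕< (#A≥0 ⊕ <⇒≤ #B>0) ⊛ 0≤-diff h)

        p>⅔L : ⅔ * L < p
        p>⅔L = ≰⇒> not-small

        above-⅔ : ∀ j → ⅔ * L < load T j
        above-⅔ j = ≤-<-trans (≤-by
          (solve 2 (λ l p → con c :* l :- p := con ⅔ :* l :+ (l :- p)) ≡.refl L p) (0≤-diff p≤L)) (full j)

        -- Every machine of A has risen above (2/3) L, so it received a job of size at least p. The
        -- total is then at least m L + p - (b - a)(p - (2/3) L), and b - a ≤ 1 makes this at least
        -- m L + (2/3) L.
        not-large : (∀ j → InA m j → ⅓ * L < load T₀ j) → ⊥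
        not-large A> = ⊥-by
          (solve 4 (λ a b l p → con ⅔ :* l :+
             ((a :+ b) :* l :- (a :* (con ⅓ :* l :+ p) :+ b :* (con c :* l :- p) :+ p)) :+
             (con 1ℚ :+ a :- b) :* (p :- con ⅔ :* l) := con 0ℚ) ≡.refl #A #B L p)
          (positive⁻¹ ⅔ ⊛< <-≤-trans p>0 p≤L ⊕< slack loadA (λ j _ → <⇒≤ (full j)) ⊕< 0≤-diff #B≤1+#A ⊛ <⇒≤ (0<-diff p>⅔L))
          where
          loadA : ∀ j → InA m j → ⅓ * L + p ≤ load T j
          loadA j a with status j
          ... | inj₁ same = ⊥-elim (<⇒≱ (above-⅔ j) (≤-trans (≤-reflexive same) (load-A j a)))
          ... | inj₂ (_ , q , p≤q ∷ _ , e) = ≤-trans (+-mono-≤ (<⇒≤ (A> j a)) p≤q) e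

        all-used : ∀ j → ¬ ¬ j ∈ us
        all-used j j∉us with status j
        ... | inj₂ (j∈us , _) = j∉us j∈us
        ... | inj₁ same with inA? j
        ... | inj₁ a = <⇒≱ (above-⅔ j) (≤-trans (≤-reflexive same) (load-A j a))
        ... | inj₂ b with load-B j b
        ... | inj₁ low = <⇒≱ (above-⅔ j) (≤-trans (≤-reflexive same) low)
        ... | inj₂ A> = not-large A>

        p>½L : ½ * L < p
        p>½L = ≤-<-trans (≤-by
          (solve 1 (λ l → con ⅔ :* l := con ½ :* l :+ con (+ 1 / 6) :* l) ≡.refl L)
          (lit (+ 1 / 6) ⊛ <⇒≤ (<-≤-trans p>0 p≤L))) p>⅔L

        impossible : ⊥
        impossible = let (j , j∉us) = free-machine p>½L in all-used j j∉us

      overflow : ∀ {x} → ¬ x + p ≤ c * L → c * L - p < x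
      overflow {x} h = subst (c * L - p <_) (solve 2 (λ x p → x :+ p :- p := x) ≡.refl x p) (+-monoˡ-< (- p) (≰⇒> h))

      -- The rule `toA` makes no load test. If the least loaded machine of A overflowed, so would
      -- all of A, and B is full by assumption, which `Full` refutes.
      fits-A : ∀ {j} → (∀ j' → InB m j' → ¬ (load T j' + p ≤ c * L)) →
        (∀ j' → InA m j' → load T j ≤ load T j') → load T j + p ≤ c * L
      fits-A {j} noB least with load T j + p ≤? c * L
      ... | yes h = h
      ... | no h = ⊥-elim (Full.impossible full)
        where
        full : ∀ j' → c * L - p < load T j'
        full j' with inA? j'
        ... | inj₁ a = <-≤-trans (overflow h) (least j' a)
        ... | inj₂ b = overflow (noB j' b)

      next : ∀ j → load T j + p ≤ c * L → ReassignInv (addJob T j p) rest (j ∷ us)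
      next j fits = reassignInv
        (trans (++⁺ʳ rest (jobs-addJob T j p)) (trans (↭-sym (shift p (jobs T) rest)) perm))
        (AllPairs.tail desc)
        count' bounded' status'
        where
        -- A pending job above `v` forces `p` above `v` by the sorted order, so `p` merely moves
        -- from the pending count to `us`.
        count' : ∀ v → 1 ℕ.≤ #above v rest → length (j ∷ us) ℕ.+ #above v rest ℕ.≤ #above v js
        count' v h with v <? p
        ... | yes v<p = ℕ.≤-trans
          (ℕ.≤-reflexive (≡.trans (≡.sym (ℕ.+-suc (length us) (#above v rest)))
            (cong (length us ℕ.+_) (≡.sym (#above-∷ rest v<p)))))
          (count v (#above-head v<p))
        ... | no v≮p = contradiction
          (subst (1 ℕ.≤_) (#above-none (All.map (λ x≤p → ≤-trans x≤p (≮⇒≥ v≮p)) (AllPairs.head desc))) h) λ ()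
        bounded' : ∀ j' → load (addJob T j p) j' ≤ c * L
        bounded' j' with j' ≟ j
        ... | yes ≡.refl = subst (_≤ c * L) (≡.sym (sum-∷ʳ (T j) p)) fits
        ... | no _ = bounded j'
        T₀≤T : load T₀ j ≤ load T j
        T₀≤T with status j
        ... | inj₁ same = ≤-reflexive (≡.sym same)
        ... | inj₂ (_ , q , p≤q ∷ _ , e) = ≤-trans (≤-by ≡.refl (≤-trans (<⇒≤ p>0) p≤q)) e
        status' : ∀ j' → Status (addJob T j p) rest (j ∷ us) j'
        status' j' with j' ≟ j
        ... | yes ≡.refl = inj₂ (here ≡.refl , p , AllPairs.head desc ,
          subst (load T₀ j + p ≤_) (≡.sym (sum-∷ʳ (T j) p)) (+-monoˡ-≤ p T₀≤T))
        ... | no _ with status j'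
        ... | inj₁ same = inj₁ same
        ... | inj₂ (i , q , _ ∷ hq , e) = inj₂ (there i , q , hq , e)

    reassign : ∀ {T rest us S} → ReassignInv T rest us → Reassign m c L T rest S → ∀ j → load S j ≤ c * L
    reassign I done = ReassignInv.bounded I
    reassign I (toB {j = j} _ fits steps) = reassign (Step.next I j fits) steps
    reassign I (toA {j = j} noB _ least steps) = reassign (Step.next I j (Step.fits-A I noB least)) steps

  -- Assembling the two bounds.

  competitive : ∀ m → 2 ℕ.≤ m → ∀ {js} → All (0ℚ <_) js → ∀ {S k} → ALG-Run m c js S k →
    (∀ S* → OfflineSchedule m js S* → makespan m S ≤ c * makespan m S*) × k ℕ.≤ 4 ℕ.* m
  competitive m 2≤m {js} js>0 {S} {k} (Sarr , arr , re , k≡) =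
    (λ S* off → ≤-trans (makespan≤ S (lit c ⊛ L≥0) (reassign start re)) (*-monoˡ-≤-nonNeg c (LB≤makespan S* 0<m js≥0 off))) ,
    subst (ℕ._≤ 4 ℕ.* m) (≡.sym k≡) few-removed
    where
    open Machines m 2≤m using (0<m; inA?)
    js≥0 : All (0ℚ ≤_) js
    js≥0 = All.map <⇒≤ js>0
    open Arrival m 2≤m
    open Removal (arrivals initial js≥0 arr)
    open Reassignment m 2≤m js>0 T load-A≤ (λ j b → proj₂ (load-B j b)) hiding (L)
    start : ReassignInv T (sortDesc R) []
    start = reassignInv kept+removed (sort-desc R)
      (λ v _ → subst (#above v (sortDesc R) ℕ.≤_) (#above-↭ v kept+removed)
        (ℕ.≤-trans (ℕ.m≤n+m _ _) (ℕ.≤-reflexive (≡.sym (#above-++ v (jobs T) (sortDesc R))))))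
      bound (λ j → inj₁ ≡.refl)
      where
      bound : ∀ j → load T j ≤ c * L
      bound j with inA? j
      ... | inj₁ a = ≤-trans (load-A≤ j a) (≤-by (solve 1 (λ l → con c :* l := con ⅔ :* l :+ l) ≡.refl L) L≥0)
      ... | inj₂ b = ≤-trans (proj₁ (load-B j b)) (≤-by
        (solve 1 (λ l → con c :* l := con (+ 4 / 3) :* l :+ con ⅓ :* l) ≡.refl L) (lit ⅓ ⊛ L≥0))

open import Data.Nat using (ℕ; _≤_; _*_)
open import Data.Integer using (+_)
open import Data.Rational using (ℚ; 0ℚ; _<_; _/_)
open import Data.List using (List)
open import Data.List.Relation.Unary.All using (All)
open import Data.Product using (_×_)

theorem4 : (m : ℕ) → 2 ≤ m → (js : List ℚ) → All (0ℚ <_) js →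
    (S : State m) (k : ℕ) → ALG-Run m (+ 5 / 3) js S k →
    ((S* : State m) → OfflineSchedule m js S* →
    makespan m S Data.Rational.≤ (+ 5 / 3) Data.Rational.* makespan m S*)
    × k ≤ 4 * m
theorem4 m 2≤m js js>0 S k run = ALG.competitive m 2≤m js>0 run
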